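{- Let $(G,\sigma)$ be a connected signed graph whose underlying graph has girth $g$. If $(G,\sigma)$ is not a balanced complete bipartite signed graph with $g=4$, not a balanced signed cycle with $g\equiv 0\pmod 4$, and not an unbalanced signed cycle with $g\equiv 2\pmod 4$, then $r(G,\sigma)\geq g$.
   Context: A signed graph $(G,\sigma)$ is a simple graph $G$ with $\sigma:E(G)\to\{+,-\}$; its adjacency matrix has $(i,j)$-entry $\sigma(v_iv_j)$ for edges and $0$ otherwise, and $r(G,\sigma)$ is its rank. A cycle is positive if the product of its edge signs is $+$, negative otherwise; a signed graph is balanced if all its cycles are positive and unbalanced otherwise. The girth $g$ is the length of a shortest cycle of $G$ (so $G$ contains a cycle). -}

module Defs where

open import Data.Nat using (ℕ; zero; suc; _≤_)
open import Data.Fin using (Fin; zero; suc; inject₁; fromℕ)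
open import Data.Bool using (Bool; true; false; if_then_else_; _xor_)
open import Data.Sign using (Sign) renaming (_*_ to _*ˢ_)
open import Data.Rational using (ℚ; 0ℚ; 1ℚ; -_; _+_; _*_)
open import Data.List using (foldr; map; allFin)
open import Data.Product using (Σ; ∃; ∃-syntax; _×_; _,_)
open import Data.Sum using (_⊎_)
open import Relation.Binary.PropositionalEquality using (_≡_)
open import Relation.Nullary using (¬_)
open import Function.Definitions using (Injective)

-- A signed (simple) graph on the vertex set Fin n.
-- 'adj' is the (symmetric, loopless) adjacency relation of the underlying
-- simple graph G; 'sgn' is the signature σ (its values on non-edges are
-- irrelevant).
record SignedGraph (n : ℕ) : Set where
  field
    adj        : Fin n → Fin n → Bool
    adj-sym    : ∀ u v → adj u v ≡ adj v u
    adj-irrefl : ∀ v → adj v v ≡ false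
    sgn        : Fin n → Fin n → Sign
    sgn-sym    : ∀ u v → sgn u v ≡ sgn v u

open SignedGraph public

module _ {n : ℕ} (G : SignedGraph n) where

  Adjacent : Fin n → Fin n → Set
  Adjacent u v = adj G u v ≡ true

  -- G is connected: any two vertices are joined by a walk
  -- p 0, p 1, ..., p k with consecutive vertices adjacent.
  Connected : Set
  Connected = ∀ u v → ∃[ k ] Σ (Fin (suc k) → Fin n) λ p →
    p zero ≡ u × p (fromℕ k) ≡ v × (∀ (i : Fin k) → Adjacent (p (inject₁ i)) (p (suc i)))

  -- A cycle of length (suc m) ≥ 3: distinct vertices c 0, ..., c m
  -- with c i ~ c (i+1) and c m ~ c 0.
  record Cycle (m : ℕ) : Set where
    field
      len≥3  : 2 ≤ m
      vert   : Fin (suc m) → Fin n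
      inj    : Injective _≡_ _≡_ vert
      step   : ∀ (i : Fin m) → Adjacent (vert (inject₁ i)) (vert (suc i))
      close  : Adjacent (vert (fromℕ m)) (vert zero)

  -- sign of a cycle: product of the signs of its edges
  cycleSign : ∀ {m} → Cycle m → Sign
  cycleSign {m} c = foldr _*ˢ_ (sgn G (vert (fromℕ m)) (vert zero))
      (map (λ i → sgn G (vert (inject₁ i)) (vert (suc i))) (allFin m))
    where open Cycle c

  -- g is the girth: G has a cycle of length g and no shorter cycle.
  Girth : ℕ → Set
  Girth g = (Σ ℕ λ m → Cycle m × suc m ≡ g) × (∀ m → Cycle m → g ≤ suc m)

  Balanced : Set
  Balanced = ∀ m (c : Cycle m) → cycleSign c ≡ Sign.+

  Unbalanced : Set
  Unbalanced = ¬ Balanced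

  -- underlying graph is complete bipartite K_{p,q} (p, q ≥ 1)
  CompleteBipartite : Set
  CompleteBipartite = Σ (Fin n → Bool) λ side →
    (∃ λ u → side u ≡ true) × (∃ λ v → side v ≡ false) ×
    (∀ u v → adj G u v ≡ side u xor side v)

  -- underlying graph is a cycle: a cycle through all n vertices
  -- such that every edge of G is an edge of that cycle.
  CycleEdge : ∀ {m} → Cycle m → Fin n → Fin n → Set
  CycleEdge {m} c u v =
    (∃ λ (i : Fin m) → (u ≡ vert (inject₁ i) × v ≡ vert (suc i))
                      ⊎ (v ≡ vert (inject₁ i) × u ≡ vert (suc i)))
    ⊎ (u ≡ vert (fromℕ m) × v ≡ vert zero)
    ⊎ (v ≡ vert (fromℕ m) × u ≡ vert zero)
    where open Cycle c

  IsCycleGraph : Set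
  IsCycleGraph = Σ ℕ λ m → Σ (Cycle m) λ c →
    suc m ≡ n × (∀ u v → Adjacent u v → CycleEdge c u v)

-- signed adjacency matrix, with rational entries
signToℚ : Sign → ℚ
signToℚ Sign.+ = 1ℚ
signToℚ Sign.- = - 1ℚ

adjMatrix : ∀ {n} → SignedGraph n → Fin n → Fin n → ℚ
adjMatrix G u v = if adj G u v then signToℚ (sgn G u v) else 0ℚ

-- finite sum over Fin k
∑ : ∀ k → (Fin k → ℚ) → ℚ
∑ zero    f = 0ℚ
∑ (suc k) f = f zero + ∑ k (λ i → f (suc i))

-- the matrix A (n × n, rational) has k linearly independent rows (over ℚ)
RankAtLeast : ∀ {n} → (Fin n → Fin n → ℚ) → ℕ → Set
RankAtLeast {n} A k = Σ (Fin k → Fin n) λ rows → Injective _≡_ _≡_ rows ×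
  (∀ (c : Fin k → ℚ) → (∀ j → ∑ k (λ i → c i * A (rows i) j) ≡ 0ℚ) → ∀ i → c i ≡ 0ℚ)

-- r is the rank of A: the maximal number of linearly independent rows
IsRank : ∀ {n} → (Fin n → Fin n → ℚ) → ℕ → Set
IsRank A r = RankAtLeast A r × ¬ RankAtLeast A (suc r)

module Submission where

-- Let C be a shortest cycle, of length g; it has no chords. Its signed adjacency matrix is
-- nonsingular unless g = 2h + 2 and (-1)^h times the sign of C is -1, i.e. unless C is balanced
-- with g ≡ 0 or unbalanced with g ≡ 2 (mod 4). This is seen by switching: rescaling a kernel
-- vector by the signs along C turns its equations into x_j + x_(j+2) = 0, so it alternates
-- along C and the two equations at the closing edge force it to vanish.
-- A degenerate C has g = 4 or g ≥ 6. For g = 4 the connected triangle-free graph G either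
-- contains an induced path on 4 vertices, whose matrix is nonsingular, or is complete bipartite;
-- then it contains a negative (hence nonsingular) 4-cycle unless it is balanced.
-- For g ≥ 6, either C is all of G, one of the excluded cycles, or some vertex y off C is
-- adjacent to C. By minimality of C, y then sees a single vertex of C, and y followed by the
-- g - 1 cycle vertices starting there is an induced path on the even number g of vertices,
-- again with nonsingular matrix. Either way the signed adjacency matrix has a nonsingular
-- principal submatrix of order g.

import Algebra.Properties.Group as GroupProperties
import Algebra.Properties.Ring as RingProperties
open import Data.Bool using (true; false; _xor_)
import Data.Bool.Properties as Bool
open import Data.Empty using (⊥; ⊥-elim)
open import Data.Fin using (Fin; zero; suc; toℕ; fromℕ; fromℕ<; inject₁)
import Data.Fin.Properties as Fin
open import Data.List using (foldr; map; allFin; tabulate)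
open import Data.List.Properties using (map-tabulate; tabulate-cong)
open import Data.Nat
  using (ℕ; zero; suc; _+_; _∸_; _%_; _≤_; _<_; z≤n; s≤s; z<s; s<s; _≤′_; ≤′-refl; ≤′-step; _≟_; _≤?_; _<?_)
open import Data.Nat.DivMod using ([m+n]%n≡m%n)
open import Data.Nat.Properties
open import Data.Product using (∃; _×_; _,_; proj₁; proj₂)
open import Data.Rational using (ℚ; 0ℚ; 1ℚ; -_; ½) renaming (_+_ to _+ℚ_; _*_ to _*ℚ_)
import Data.Rational.Properties as ℚ
open import Data.Sign using (Sign; opposite) renaming (_*_ to _*ˢ_)
import Data.Sign.Properties as Sign
open import Data.Sum using (_⊎_; inj₁; inj₂)
open import Function using (_∘_)
open import Relation.Binary.Definitions using (tri<; tri≈; tri>)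
open import Relation.Binary.PropositionalEquality
open import Relation.Nullary using (¬_; Dec; yes; no)
open import Relation.Nullary.Decidable using (_×-dec_; _⊎-dec_; ¬?; decidable-stable)

open import Defs

private
  module ℚ-Group = GroupProperties ℚ.+-0-group
  module ℚ-Ring = RingProperties ℚ.+-*-ring

-- Signs acting on ℚ

infixr 8 _◃_
_◃_ : Sign → ℚ → ℚ
Sign.+ ◃ x = x
Sign.- ◃ x = - x

*-signToℚ : ∀ s x → x *ℚ signToℚ s ≡ s ◃ x
*-signToℚ Sign.+ x = ℚ.*-identityʳ x
*-signToℚ Sign.- x = trans (ℚ.*-comm x (- 1ℚ)) (ℚ-Ring.-1*x≈-x x)

◃-zero : ∀ s → s ◃ 0ℚ ≡ 0ℚ
◃-zero Sign.+ = refl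
◃-zero Sign.- = refl

◃-distrib-+ : ∀ s x y → s ◃ (x +ℚ y) ≡ s ◃ x +ℚ s ◃ y
◃-distrib-+ Sign.+ x y = refl
◃-distrib-+ Sign.- x y = ℚ.neg-distrib-+ x y

◃-◃ : ∀ s t x → s ◃ t ◃ x ≡ (s *ˢ t) ◃ x
◃-◃ Sign.+ t x = refl
◃-◃ Sign.- Sign.+ x = refl
◃-◃ Sign.- Sign.- x = ℚ-Group.⁻¹-involutive x

◃-involutive : ∀ s x → s ◃ s ◃ x ≡ x
◃-involutive s x = trans (◃-◃ s s x) (cong (_◃ x) (Sign.s*s≡+ s))

neg-◃ : ∀ s x → - (s ◃ x) ≡ opposite s ◃ x
neg-◃ Sign.+ x = refl
neg-◃ Sign.- x = ℚ-Group.⁻¹-involutive x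

s◃x≡0⇒x≡0 : ∀ s {x} → s ◃ x ≡ 0ℚ → x ≡ 0ℚ
s◃x≡0⇒x≡0 s {x} eq = begin
  x           ≡⟨ ◃-involutive s x ⟨
  s ◃ s ◃ x   ≡⟨ cong (s ◃_) eq ⟩
  s ◃ 0ℚ      ≡⟨ ◃-zero s ⟩
  0ℚ          ∎
  where open ≡-Reasoning

x+x≡0⇒x≡0 : ∀ {x} → x +ℚ x ≡ 0ℚ → x ≡ 0ℚ
x+x≡0⇒x≡0 {x} eq = begin
  x                    ≡⟨ ℚ.*-identityʳ x ⟨
  x *ℚ (½ +ℚ ½)        ≡⟨ ℚ.*-distribˡ-+ x ½ ½ ⟩
  x *ℚ ½ +ℚ x *ℚ ½     ≡⟨ ℚ.*-distribʳ-+ ½ x x ⟨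
  (x +ℚ x) *ℚ ½        ≡⟨ cong (_*ℚ ½) eq ⟩
  0ℚ *ℚ ½              ≡⟨ ℚ.*-zeroˡ ½ ⟩
  0ℚ                   ∎
  where open ≡-Reasoning

s◃x≡opposite[s]◃x⇒x≡0 : ∀ s {x} → s ◃ x ≡ opposite s ◃ x → x ≡ 0ℚ
s◃x≡opposite[s]◃x⇒x≡0 Sign.+ {x} eq = x+x≡0⇒x≡0 (trans (cong (x +ℚ_) eq) (ℚ.+-inverseʳ x))
s◃x≡opposite[s]◃x⇒x≡0 Sign.- {x} eq = x+x≡0⇒x≡0 (trans (cong (_+ℚ x) (sym eq)) (ℚ.+-inverseˡ x))

x+s◃y≡0⇒x≡-s◃y : ∀ {x} s y → x +ℚ s ◃ y ≡ 0ℚ → x ≡ opposite s ◃ y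
x+s◃y≡0⇒x≡-s◃y s y eq = trans (ℚ-Group.inverseˡ-unique _ (s ◃ y) eq) (neg-◃ s y)

[s*t]*t≡s : ∀ s t → (s *ˢ t) *ˢ t ≡ s
[s*t]*t≡s s t = trans (Sign.*-assoc s t t) (trans (cong (s *ˢ_) (Sign.s*s≡+ t)) (Sign.*-identityʳ s))

[t*s]*t≡s : ∀ s t → (t *ˢ s) *ˢ t ≡ s
[t*s]*t≡s s t = trans (cong (_*ˢ t) (Sign.*-comm t s)) ([s*t]*t≡s s t)

t*[t*s]≡s : ∀ s t → t *ˢ (t *ˢ s) ≡ s
t*[t*s]≡s s t = trans (sym (Sign.*-assoc t t s)) (cong (_*ˢ s) (Sign.s*s≡+ t))

t*s≡+⇒s≡t : ∀ {s t} → t *ˢ s ≡ Sign.+ → s ≡ t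
t*s≡+⇒s≡t {s} {t} t*s≡+ = Sign.*-cancelˡ-≡ t s t (trans t*s≡+ (sym (Sign.s*s≡+ t)))

s*opposite[t]≡opposite[s*t] : ∀ s t → s *ˢ opposite t ≡ opposite (s *ˢ t)
s*opposite[t]≡opposite[s*t] Sign.+ t = refl
s*opposite[t]≡opposite[s*t] Sign.- t = refl

s≢t⇒s≡opposite[t] : ∀ {s t} → s ≢ t → s ≡ opposite t
s≢t⇒s≡opposite[t] {Sign.+} {Sign.+} s≢t = ⊥-elim (s≢t refl)
s≢t⇒s≡opposite[t] {Sign.+} {Sign.-} _   = refl
s≢t⇒s≡opposite[t] {Sign.-} {Sign.+} _   = refl
s≢t⇒s≡opposite[t] {Sign.-} {Sign.-} s≢t = ⊥-elim (s≢t refl)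

[s*t]*[t*u]≡s*u : ∀ s t u → (s *ˢ t) *ˢ (t *ˢ u) ≡ s *ˢ u
[s*t]*[t*u]≡s*u Sign.+ Sign.+ u = refl
[s*t]*[t*u]≡s*u Sign.+ Sign.- u = Sign.opposite-involutive u
[s*t]*[t*u]≡s*u Sign.- Sign.+ u = refl
[s*t]*[t*u]≡s*u Sign.- Sign.- u = refl

[s*t]*u≡[t*u]*s : ∀ s t u → (s *ˢ t) *ˢ u ≡ (t *ˢ u) *ˢ s
[s*t]*u≡[t*u]*s s t u = trans (Sign.*-assoc s t u) (Sign.*-comm s (t *ˢ u))

[s*t]*u≡[s*u]*t : ∀ s t u → (s *ˢ t) *ˢ u ≡ (s *ˢ u) *ˢ t
[s*t]*u≡[s*u]*t s t u = trans (Sign.*-assoc s t u) (trans (cong (s *ˢ_) (Sign.*-comm t u)) (sym (Sign.*-assoc s u t)))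

signProduct : (ℕ → Sign) → ℕ → Sign
signProduct s zero    = Sign.+
signProduct s (suc i) = signProduct s i *ˢ s i

signProduct-suc : ∀ s m → signProduct s (suc m) ≡ s 0 *ˢ signProduct (λ i → s (suc i)) m
signProduct-suc s zero    = Sign.*-comm Sign.+ (s 0)
signProduct-suc s (suc m) = trans (cong (_*ˢ s (suc m)) (signProduct-suc s m)) (Sign.*-assoc (s 0) _ _)

foldr-tabulate-signProduct : ∀ m (s : ℕ → Sign) z →
  foldr _*ˢ_ z (tabulate {n = m} (λ i → s (toℕ i))) ≡ signProduct s m *ˢ z
foldr-tabulate-signProduct zero    s z = refl
foldr-tabulate-signProduct (suc m) s z = begin
  s 0 *ˢ foldr _*ˢ_ z (tabulate {n = m} (λ i → s (suc (toℕ i))))  ≡⟨ cong (s 0 *ˢ_) (foldr-tabulate-signProduct m (λ i → s (suc i)) z) ⟩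
  s 0 *ˢ (signProduct (λ i → s (suc i)) m *ˢ z)          ≡⟨ Sign.*-assoc (s 0) _ z ⟨
  (s 0 *ˢ signProduct (λ i → s (suc i)) m) *ˢ z          ≡⟨ cong (_*ˢ z) (signProduct-suc s m) ⟨
  signProduct s (suc m) *ˢ z                             ∎
  where open ≡-Reasoning

-- Parity bookkeeping

alternating : ℕ → Sign
alternating zero    = Sign.+
alternating (suc i) = opposite (alternating i)

+-double-suc : ∀ r i → r + (suc i + suc i) ≡ suc (suc (r + (i + i)))
+-double-suc r i = begin
  r + (suc i + suc i)      ≡⟨ cong (λ x → r + suc x) (+-suc i i) ⟩
  r + suc (suc (i + i))    ≡⟨ +-suc r (suc (i + i)) ⟩
  suc (r + suc (i + i))    ≡⟨ cong suc (+-suc r (i + i)) ⟩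
  suc (suc (r + (i + i)))  ∎
  where open ≡-Reasoning

[2+2[2+h]]%4≡[2+2h]%4 : ∀ h → suc (suc (suc (suc h) + suc (suc h))) % 4 ≡ suc (suc (h + h)) % 4
[2+2[2+h]]%4≡[2+2h]%4 h = trans (cong (_% 4) shift) ([m+n]%n≡m%n (suc (suc (h + h))) 4)
  where
  shift : suc (suc (suc (suc h) + suc (suc h))) ≡ suc (suc (h + h)) + 4
  shift = trans (cong (λ x → suc (suc (suc (suc x)))) (trans (+-suc h (suc h)) (cong suc (+-suc h h))))
                (+-comm 4 (suc (suc (h + h))))

even-or-odd : ∀ i → ∃ λ j → i ≡ j + j ⊎ i ≡ suc (j + j)
even-or-odd zero          = 0 , inj₁ refl
even-or-odd (suc zero)    = 0 , inj₂ refl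
even-or-odd (suc (suc i)) with even-or-odd i
... | j , inj₁ refl = suc j , inj₁ (cong suc (sym (+-suc j j)))
... | j , inj₂ refl = suc j , inj₂ (cong (λ x → suc (suc x)) (sym (+-suc j j)))

cycleLength-parity : ∀ {m} → 2 ≤ m → ∃ λ h → m ≡ suc (suc (h + h)) ⊎ m ≡ suc (h + h)
cycleLength-parity {m} 2≤m with even-or-odd m
... | zero  , inj₁ refl = ⊥-elim (≤⇒≯ 2≤m z<s)
... | suc h , inj₁ refl = h , inj₁ (cong suc (+-suc h h))
... | h     , inj₂ refl = h , inj₂ refl

alternating-residue : ∀ h → (alternating h ≡ Sign.+ × suc (suc (h + h)) % 4 ≡ 2)
                          ⊎ (alternating h ≡ Sign.- × suc (suc (h + h)) % 4 ≡ 0)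
alternating-residue zero          = inj₁ (refl , refl)
alternating-residue (suc zero)    = inj₂ (refl , refl)
alternating-residue (suc (suc h)) with alternating-residue h
... | inj₁ (alt≡+ , residue) = inj₁ (trans (Sign.opposite-involutive _) alt≡+ , trans ([2+2[2+h]]%4≡[2+2h]%4 h) residue)
... | inj₂ (alt≡- , residue) = inj₂ (trans (Sign.opposite-involutive _) alt≡- , trans ([2+2[2+h]]%4≡[2+2h]%4 h) residue)

-- The degenerate signed even cycles are exactly the exceptional cycles of the theorem.
degenerate-residue : ∀ h σ → alternating h *ˢ σ ≢ Sign.+ →
                     (σ ≡ Sign.+ × suc (suc (h + h)) % 4 ≡ 0) ⊎ (σ ≡ Sign.- × suc (suc (h + h)) % 4 ≡ 2)
degenerate-residue h Sign.+ degenerate with alternating-residue h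
... | inj₁ (alt≡+ , _)       = ⊥-elim (degenerate (trans (Sign.*-identityʳ _) alt≡+))
... | inj₂ (_ , residue)     = inj₁ (refl , residue)
degenerate-residue h Sign.- degenerate with alternating-residue h
... | inj₁ (_ , residue)     = inj₂ (refl , residue)
... | inj₂ (alt≡- , _)       = ⊥-elim (degenerate (cong (_*ˢ Sign.-) alt≡-))

alternation : ∀ k (e : ℕ → ℚ) → (∀ j → suc (suc j) < k → e j +ℚ e (suc (suc j)) ≡ 0ℚ) →
              ∀ r i → r + (i + i) < k → e (r + (i + i)) ≡ alternating i ◃ e r
alternation k e step r zero    _ = cong e (+-identityʳ r)
alternation k e step r (suc i) p rewrite +-double-suc r i = begin
  e (suc (suc (r + (i + i))))         ≡⟨ ℚ-Group.inverseʳ-unique _ _ (step (r + (i + i)) p) ⟩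
  - e (r + (i + i))                   ≡⟨ cong -_ (alternation k e step r i (<-trans (n<1+n _) (<-trans (n<1+n _) p))) ⟩
  - (alternating i ◃ e r)             ≡⟨ neg-◃ (alternating i) (e r) ⟩
  opposite (alternating i) ◃ e r      ∎
  where open ≡-Reasoning

alternation-zero : ∀ k (e : ℕ → ℚ) → (∀ j → suc (suc j) < k → e j +ℚ e (suc (suc j)) ≡ 0ℚ) →
                   e 0 ≡ 0ℚ → e 1 ≡ 0ℚ → ∀ i → i < k → e i ≡ 0ℚ
alternation-zero k e step e0≡0 e1≡0 i i<k with even-or-odd i
... | j , inj₁ refl = begin
  e (j + j)               ≡⟨ alternation k e step 0 j i<k ⟩
  alternating j ◃ e 0     ≡⟨ cong (alternating j ◃_) e0≡0 ⟩
  alternating j ◃ 0ℚ      ≡⟨ ◃-zero (alternating j) ⟩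
  0ℚ                      ∎
  where open ≡-Reasoning
... | j , inj₂ refl = begin
  e (suc (j + j))         ≡⟨ alternation k e step 1 j i<k ⟩
  alternating j ◃ e 1     ≡⟨ cong (alternating j ◃_) e1≡0 ⟩
  alternating j ◃ 0ℚ      ≡⟨ ◃-zero (alternating j) ⟩
  0ℚ                      ∎
  where open ≡-Reasoning

-- Finite sums and vertex sequences

∑< : ℕ → (ℕ → ℚ) → ℚ
∑< zero    f = 0ℚ
∑< (suc k) f = f 0 +ℚ ∑< k (λ i → f (suc i))

∑≡∑< : ∀ k (f : Fin k → ℚ) (g : ℕ → ℚ) → (∀ i → f i ≡ g (toℕ i)) → ∑ k f ≡ ∑< k g
∑≡∑< zero    f g f≗g = refl
∑≡∑< (suc k) f g f≗g = cong₂ _+ℚ_ (f≗g zero) (∑≡∑< k (λ i → f (suc i)) (λ i → g (suc i)) (λ i → f≗g (suc i)))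

∑<-zero : ∀ k f → (∀ i → i < k → f i ≡ 0ℚ) → ∑< k f ≡ 0ℚ
∑<-zero zero    f f≡0 = refl
∑<-zero (suc k) f f≡0 = cong₂ _+ℚ_ (f≡0 0 z<s) (∑<-zero k _ λ i i<k → f≡0 (suc i) (s<s i<k))

∑<-single : ∀ k f a → a < k → (∀ i → i < k → i ≢ a → f i ≡ 0ℚ) → ∑< k f ≡ f a
∑<-single (suc k) f zero    _         f≡0 = begin
  f 0 +ℚ ∑< k (λ i → f (suc i))   ≡⟨ cong (f 0 +ℚ_) (∑<-zero k _ (λ i i<k → f≡0 (suc i) (s<s i<k) λ ())) ⟩
  f 0 +ℚ 0ℚ                       ≡⟨ ℚ.+-identityʳ (f 0) ⟩
  f 0                             ∎
  where open ≡-Reasoning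
∑<-single (suc k) f (suc a) (s<s a<k) f≡0 = begin
  f 0 +ℚ ∑< k (λ i → f (suc i))   ≡⟨ cong₂ _+ℚ_ (f≡0 0 z<s λ ()) (∑<-single k _ a a<k λ i i<k i≢a → f≡0 (suc i) (s<s i<k) (i≢a ∘ suc-injective)) ⟩
  0ℚ +ℚ f (suc a)                 ≡⟨ ℚ.+-identityˡ (f (suc a)) ⟩
  f (suc a)                       ∎
  where open ≡-Reasoning

∑<-pair : ∀ k f a b → a < k → b < k → a ≢ b → (∀ i → i < k → i ≢ a → i ≢ b → f i ≡ 0ℚ) →
          ∑< k f ≡ f a +ℚ f b
∑<-pair (suc k) f zero    zero    _         _         a≢b _   = ⊥-elim (a≢b refl)
∑<-pair (suc k) f zero    (suc b) _         (s<s b<k) _   f≡0 =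
  cong (f 0 +ℚ_) (∑<-single k _ b b<k λ i i<k i≢b → f≡0 (suc i) (s<s i<k) (λ ()) (i≢b ∘ suc-injective))
∑<-pair (suc k) f (suc a) zero    (s<s a<k) _         _   f≡0 = begin
  f 0 +ℚ ∑< k (λ i → f (suc i))   ≡⟨ cong (f 0 +ℚ_) (∑<-single k _ a a<k λ i i<k i≢a → f≡0 (suc i) (s<s i<k) (i≢a ∘ suc-injective) (λ ())) ⟩
  f 0 +ℚ f (suc a)                ≡⟨ ℚ.+-comm (f 0) (f (suc a)) ⟩
  f (suc a) +ℚ f 0                ∎
  where open ≡-Reasoning
∑<-pair (suc k) f (suc a) (suc b) (s<s a<k) (s<s b<k) a≢b f≡0 = begin
  f 0 +ℚ ∑< k (λ i → f (suc i))   ≡⟨ cong₂ _+ℚ_ (f≡0 0 z<s (λ ()) (λ ())) (∑<-pair k _ a b a<k b<k (a≢b ∘ cong suc)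
                                         λ i i<k i≢a i≢b → f≡0 (suc i) (s<s i<k) (i≢a ∘ suc-injective) (i≢b ∘ suc-injective)) ⟩
  0ℚ +ℚ (f (suc a) +ℚ f (suc b))  ≡⟨ ℚ.+-identityˡ _ ⟩
  f (suc a) +ℚ f (suc b)          ∎
  where open ≡-Reasoning

toSeq : ∀ {m} {A : Set} → (Fin (suc m) → A) → ℕ → A
toSeq {zero}  f i       = f zero
toSeq {suc m} f zero    = f zero
toSeq {suc m} f (suc i) = toSeq (λ x → f (suc x)) i

toSeq-toℕ : ∀ {m} {A : Set} (f : Fin (suc m) → A) x → toSeq f (toℕ x) ≡ f x
toSeq-toℕ {zero}  f zero    = refl
toSeq-toℕ {suc m} f zero    = refl
toSeq-toℕ {suc m} f (suc x) = toSeq-toℕ (λ x → f (suc x)) x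

toSeq-at : ∀ {m} {A : Set} (f : Fin (suc m) → A) x {i} → toℕ x ≡ i → f x ≡ toSeq f i
toSeq-at f x refl = sym (toSeq-toℕ f x)

toSeq-fromℕ< : ∀ {m} {A : Set} (f : Fin (suc m) → A) {i} (i<k : i < suc m) → toSeq f i ≡ f (fromℕ< i<k)
toSeq-fromℕ< f i<k = sym (toSeq-at f (fromℕ< i<k) (Fin.toℕ-fromℕ< i<k))

first-exit : ∀ {A : Set} {P : A → Set} → (∀ x → Dec (P x)) → ∀ k (p : Fin (suc k) → A) →
             P (p zero) → ¬ P (p (fromℕ k)) → ∃ λ (i : Fin k) → P (p (inject₁ i)) × ¬ P (p (suc i))
first-exit P? zero    p p0 ¬pk = ⊥-elim (¬pk p0)
first-exit P? (suc k) p p0 ¬pk with P? (p (suc zero))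
... | no  ¬p1 = zero , p0 , ¬p1
... | yes p1 with first-exit P? k (λ i → p (suc i)) p1 ¬pk
...   | i , pi , ¬pi+1 = suc i , pi , ¬pi+1

CycleNeighbours : ℕ → ℕ → ℕ → Set
CycleNeighbours m i j = suc i ≡ j ⊎ suc j ≡ i ⊎ (i ≡ m × j ≡ 0) ⊎ (j ≡ m × i ≡ 0)

CycleNeighbours? : ∀ m i j → Dec (CycleNeighbours m i j)
CycleNeighbours? m i j = (suc i ≟ j) ⊎-dec (suc j ≟ i) ⊎-dec ((i ≟ m) ×-dec (j ≟ 0)) ⊎-dec ((j ≟ m) ×-dec (i ≟ 0))

module _ {n : ℕ} where

  InjectiveOn : ℕ → (ℕ → Fin n) → Set
  InjectiveOn k u = ∀ i j → i < k → j < k → u i ≡ u j → i ≡ j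

  InjectiveOn-≤ : ∀ {k l} {w : ℕ → Fin n} → k ≤ l → InjectiveOn l w → InjectiveOn k w
  InjectiveOn-≤ k≤l w-inj i j i<k j<k = w-inj i j (<-≤-trans i<k k≤l) (<-≤-trans j<k k≤l)

  Outside : ℕ → (ℕ → Fin n) → Fin n → Set
  Outside m w y = ∀ i → i ≤ m → w i ≢ y

  Outside-≤ : ∀ {k m w y} → k ≤ m → Outside m w y → Outside k w y
  Outside-≤ k≤m out i i≤k = out i (≤-trans i≤k k≤m)

  prepend : Fin n → (ℕ → Fin n) → ℕ → Fin n
  prepend y w zero    = y
  prepend y w (suc i) = w i

  prepend-injective : ∀ {k w y} → InjectiveOn (suc k) w → Outside k w y → InjectiveOn (suc (suc k)) (prepend y w)
  prepend-injective w-inj out zero    zero    _           _           _  = refl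
  prepend-injective w-inj out zero    (suc j) _           (s<s j<1+k) eq = ⊥-elim (out j (≤-pred j<1+k) (sym eq))
  prepend-injective w-inj out (suc i) zero    (s<s i<1+k) _           eq = ⊥-elim (out i (≤-pred i<1+k) eq)
  prepend-injective w-inj out (suc i) (suc j) (s<s i<1+k) (s<s j<1+k) eq = cong suc (w-inj i j i<1+k j<1+k eq)

  quad : Fin n → Fin n → Fin n → Fin n → ℕ → Fin n
  quad x y z t = prepend x (prepend y (prepend z (λ _ → t)))

  rotate₁ : ℕ → (ℕ → Fin n) → ℕ → Fin n
  rotate₁ m w t with t <? m
  ... | yes _ = w (suc t)
  ... | no  _ = w 0

  rotate₁-< : ∀ m w {t} → t < m → rotate₁ m w t ≡ w (suc t)
  rotate₁-< m w {t} t<m with t <? m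
  ... | yes _   = refl
  ... | no  t≮m = ⊥-elim (t≮m t<m)

  rotate₁-last : ∀ m w → rotate₁ m w m ≡ w 0
  rotate₁-last m w with m <? m
  ... | yes m<m = ⊥-elim (<-irrefl refl m<m)
  ... | no  _   = refl

  Outside-rotate₁ : ∀ {m w y} → Outside m w y → Outside m (rotate₁ m w) y
  Outside-rotate₁ {m} {w} out t t≤m with t <? m
  ... | yes t<m = out (suc t) t<m
  ... | no  _   = out 0 z≤n

  rotate : ℕ → ℕ → (ℕ → Fin n) → ℕ → Fin n
  rotate m zero    w = w
  rotate m (suc r) w = rotate m r (rotate₁ m w)

  Outside-rotate : ∀ {m} r {w y} → Outside m w y → Outside m (rotate m r w) y
  Outside-rotate zero    out = out
  Outside-rotate (suc r) out = Outside-rotate r (Outside-rotate₁ out)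

  rotate-zero : ∀ m r w → r ≤ m → rotate m r w 0 ≡ w r
  rotate-zero m zero    w _   = refl
  rotate-zero m (suc r) w r<m = trans (rotate-zero m r (rotate₁ m w) (<⇒≤ r<m)) (rotate₁-< m w r<m)

  reflect : ℕ → (ℕ → Fin n) → ℕ → Fin n
  reflect m w zero    = w 0
  reflect m w (suc t) = w (m ∸ t)

  Outside-reflect : ∀ {m w y} → Outside m w y → Outside m (reflect m w) y
  Outside-reflect {m} out zero    _ = out 0 z≤n
  Outside-reflect {m} out (suc t) _ = out (m ∸ t) (m∸n≤m m t)

  reflect-suc[m∸t] : ∀ m w {t} → t ≤ m → reflect m w (suc (m ∸ t)) ≡ w t
  reflect-suc[m∸t] m w t≤m = cong w (m∸[m∸n]≡n t≤m)

-- Rank from nonsingular principal submatrices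

fromFin : ∀ {k} → (Fin k → ℚ) → ℕ → ℚ
fromFin {zero}  c i       = 0ℚ
fromFin {suc k} c zero    = c zero
fromFin {suc k} c (suc i) = fromFin (c ∘ suc) i

fromFin-toℕ : ∀ {k} (c : Fin k → ℚ) i → fromFin c (toℕ i) ≡ c i
fromFin-toℕ c zero    = refl
fromFin-toℕ c (suc i) = fromFin-toℕ (c ∘ suc) i

module _ {n : ℕ} (A : Fin n → Fin n → ℚ) where

  NonsingularOn : ℕ → (ℕ → Fin n) → Set
  NonsingularOn k u = ∀ (d : ℕ → ℚ) → (∀ j → j < k → ∑< k (λ i → d i *ℚ A (u i) (u j)) ≡ 0ℚ) →
                      ∀ i → i < k → d i ≡ 0ℚ

  -- A repeated row u i = u j would give the dependency e_i - e_j.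
  nonsingular⇒injective : ∀ {k u} → NonsingularOn k u → InjectiveOn k u
  nonsingular⇒injective {k} {u} nonsingular i j i<k j<k ui≡uj with i ≟ j
  ... | yes i≡j = i≡j
  ... | no  i≢j = ⊥-elim (1≢0 (trans (sym d-i) (nonsingular d column≡0 i i<k)))
    where
    1≢0 : 1ℚ ≢ 0ℚ
    1≢0 ()

    d : ℕ → ℚ
    d l with l ≟ i | l ≟ j
    ... | yes _ | _     = 1ℚ
    ... | no  _ | yes _ = - 1ℚ
    ... | no  _ | no  _ = 0ℚ

    d-i : d i ≡ 1ℚ
    d-i with i ≟ i
    ... | yes _  = refl
    ... | no i≢i = ⊥-elim (i≢i refl)

    d-j : d j ≡ - 1ℚ
    d-j with j ≟ i | j ≟ j
    ... | yes j≡i | _      = ⊥-elim (i≢j (sym j≡i))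
    ... | no  _   | yes _  = refl
    ... | no  _   | no j≢j = ⊥-elim (j≢j refl)

    d-other : ∀ l → l ≢ i → l ≢ j → d l ≡ 0ℚ
    d-other l l≢i l≢j with l ≟ i | l ≟ j
    ... | yes l≡i | _       = ⊥-elim (l≢i l≡i)
    ... | no  _   | yes l≡j = ⊥-elim (l≢j l≡j)
    ... | no  _   | no  _   = refl

    column≡0 : ∀ c → c < k → ∑< k (λ l → d l *ℚ A (u l) (u c)) ≡ 0ℚ
    column≡0 c _ = begin
      ∑< k (λ l → d l *ℚ A (u l) (u c))              ≡⟨ ∑<-pair k (λ l → d l *ℚ A (u l) (u c)) i j i<k j<k i≢j (λ l _ l≢i l≢j →
                                                          trans (cong (_*ℚ A (u l) (u c)) (d-other l l≢i l≢j)) (ℚ.*-zeroˡ (A (u l) (u c)))) ⟩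
      d i *ℚ A (u i) (u c) +ℚ d j *ℚ A (u j) (u c)   ≡⟨ cong₂ (λ x y → x *ℚ X +ℚ y *ℚ A (u j) (u c)) d-i d-j ⟩
      1ℚ *ℚ X +ℚ (- 1ℚ) *ℚ A (u j) (u c)             ≡⟨ cong (λ v → 1ℚ *ℚ X +ℚ (- 1ℚ) *ℚ A v (u c)) (sym ui≡uj) ⟩
      1ℚ *ℚ X +ℚ (- 1ℚ) *ℚ X                         ≡⟨ ℚ.*-distribʳ-+ X 1ℚ (- 1ℚ) ⟨
      (1ℚ +ℚ - 1ℚ) *ℚ X                              ≡⟨ cong (_*ℚ X) (ℚ.+-inverseʳ 1ℚ) ⟩
      0ℚ *ℚ X                                        ≡⟨ ℚ.*-zeroˡ X ⟩
      0ℚ                                             ∎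
      where
      open ≡-Reasoning
      X : ℚ
      X = A (u i) (u c)

  rankAtLeast-nonsingular : ∀ k u → NonsingularOn k u → RankAtLeast A k
  rankAtLeast-nonsingular k u nonsingular =
    (λ i → u (toℕ i)) ,
    (λ eq → Fin.toℕ-injective (nonsingular⇒injective nonsingular _ _ (Fin.toℕ<n _) (Fin.toℕ<n _) eq)) ,
    independent
    where
    independent : ∀ c → (∀ j → ∑ k (λ i → c i *ℚ A (u (toℕ i)) j) ≡ 0ℚ) → ∀ i → c i ≡ 0ℚ
    independent c combination≡0 i = begin
      c i                 ≡⟨ fromFin-toℕ c i ⟨
      fromFin c (toℕ i)   ≡⟨ nonsingular (fromFin c) column≡0 (toℕ i) (Fin.toℕ<n i) ⟩
      0ℚ                  ∎
      where
      open ≡-Reasoning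
      column≡0 : ∀ j → j < k → ∑< k (λ i → fromFin c i *ℚ A (u i) (u j)) ≡ 0ℚ
      column≡0 j _ = trans
        (sym (∑≡∑< k (λ i → c i *ℚ A (u (toℕ i)) (u j)) _ λ i → cong (_*ℚ A (u (toℕ i)) (u j)) (sym (fromFin-toℕ c i))))
        (combination≡0 (u j))

  rankAtLeast-pred : ∀ {k} → RankAtLeast A (suc k) → RankAtLeast A k
  rankAtLeast-pred {k} (rows , rows-inj , independent) =
    (λ i → rows (suc i)) , (Fin.suc-injective ∘ rows-inj) , λ c combination≡0 i →
      independent (padded c) (λ j → trans (cong (_+ℚ ∑ k (λ i → c i *ℚ A (rows (suc i)) j)) (ℚ.*-zeroˡ (A (rows zero) j)))
                                          (trans (ℚ.+-identityˡ _) (combination≡0 j))) (suc i)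
    where
    padded : (Fin k → ℚ) → Fin (suc k) → ℚ
    padded c zero    = 0ℚ
    padded c (suc i) = c i

  rankAtLeast-≤′ : ∀ {k l} → l ≤′ k → RankAtLeast A k → RankAtLeast A l
  rankAtLeast-≤′ ≤′-refl       rank≥k = rank≥k
  rankAtLeast-≤′ (≤′-step l≤′k) rank≥k = rankAtLeast-≤′ l≤′k (rankAtLeast-pred rank≥k)

  rankAtLeast⇒≤rank : ∀ {k r} → RankAtLeast A k → IsRank A r → k ≤ r
  rankAtLeast⇒≤rank {k} {r} rank≥k (_ , rank≱1+r) with k ≤? r
  ... | yes k≤r = k≤r
  ... | no  k≰r = ⊥-elim (rank≱1+r (rankAtLeast-≤′ (≤⇒≤′ (≰⇒> k≰r)) rank≥k))

-- Signed graphs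

module _ {n : ℕ} (G : SignedGraph n) where

  Nonadjacent : Fin n → Fin n → Set
  Nonadjacent x y = adj G x y ≡ false

  Adjacent-sym : ∀ {x y} → Adjacent G x y → Adjacent G y x
  Adjacent-sym {x} {y} x~y = trans (adj-sym G y x) x~y

  Nonadjacent-sym : ∀ {x y} → Nonadjacent x y → Nonadjacent y x
  Nonadjacent-sym {x} {y} x≁y = trans (adj-sym G y x) x≁y

  Adjacent⇒≢ : ∀ {x y} → Adjacent G x y → x ≢ y
  Adjacent⇒≢ {x} x~x refl with trans (sym x~x) (adj-irrefl G x)
  ... | ()

  ¬Adjacent⇒Nonadjacent : ∀ {x y} → ¬ Adjacent G x y → Nonadjacent x y
  ¬Adjacent⇒Nonadjacent {x} {y} x≁y with adj G x y
  ... | true  = ⊥-elim (x≁y refl)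
  ... | false = refl

  Adjacent⇒¬Nonadjacent : ∀ {x y} → Adjacent G x y → ¬ Nonadjacent x y
  Adjacent⇒¬Nonadjacent x~y x≁y with trans (sym x~y) x≁y
  ... | ()

  crossing-edge : Connected G → ∀ {P : Fin n → Set} → (∀ v → Dec (P v)) → ∀ {x y} → P x → ¬ P y →
                  ∃ λ q → ∃ λ z → P q × ¬ P z × Adjacent G q z
  crossing-edge connected {P} P? {x} {y} px ¬py with connected x y
  ... | k , p , p0≡x , pk≡y , steps with first-exit P? k p (subst P (sym p0≡x) px) (¬py ∘ subst P pk≡y)
  ...   | i , pq , ¬pz = p (inject₁ i) , p (suc i) , pq , ¬pz , steps i

  *-adjMatrix-adjacent : ∀ {x y} d → Adjacent G x y → d *ℚ adjMatrix G x y ≡ sgn G x y ◃ d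
  *-adjMatrix-adjacent {x} {y} d x~y rewrite x~y = *-signToℚ (sgn G x y) d

  *-adjMatrix-nonadjacent : ∀ {x y} d → Nonadjacent x y → d *ℚ adjMatrix G x y ≡ 0ℚ
  *-adjMatrix-nonadjacent d x≁y rewrite x≁y = ℚ.*-zeroʳ d

  column-single : ∀ k (u : ℕ → Fin n) (d : ℕ → ℚ) j a → a < k → Adjacent G (u a) (u j) →
    (∀ i → i < k → i ≢ a → Nonadjacent (u i) (u j)) →
    ∑< k (λ i → d i *ℚ adjMatrix G (u i) (u j)) ≡ sgn G (u a) (u j) ◃ d a
  column-single k u d j a a<k a~j others = trans
    (∑<-single k (λ i → d i *ℚ adjMatrix G (u i) (u j)) a a<k
      λ i i<k i≢a → *-adjMatrix-nonadjacent {u i} {u j} (d i) (others i i<k i≢a))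
    (*-adjMatrix-adjacent {u a} {u j} (d a) a~j)

  column-pair : ∀ k (u : ℕ → Fin n) (d : ℕ → ℚ) j a b → a < k → b < k → a ≢ b →
    Adjacent G (u a) (u j) → Adjacent G (u b) (u j) →
    (∀ i → i < k → i ≢ a → i ≢ b → Nonadjacent (u i) (u j)) →
    ∑< k (λ i → d i *ℚ adjMatrix G (u i) (u j)) ≡ sgn G (u a) (u j) ◃ d a +ℚ sgn G (u b) (u j) ◃ d b
  column-pair k u d j a b a<k b<k a≢b a~j b~j others = trans
    (∑<-pair k (λ i → d i *ℚ adjMatrix G (u i) (u j)) a b a<k b<k a≢b
      λ i i<k i≢a i≢b → *-adjMatrix-nonadjacent {u i} {u j} (d i) (others i i<k i≢a i≢b))
    (cong₂ _+ℚ_ (*-adjMatrix-adjacent {u a} {u j} (d a) a~j) (*-adjMatrix-adjacent {u b} {u j} (d b) b~j))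

  pathSign : (ℕ → Fin n) → ℕ → Sign
  pathSign u = signProduct (λ i → sgn G (u i) (u (suc i)))

  -- Rescaling d i by the sign of the walk u 0, …, u i turns the equation of a column whose
  -- only neighbours among the rows are its two walk neighbours into an unsigned one.
  module Switching (u : ℕ → Fin n) (d : ℕ → ℚ) where

    switched : ℕ → ℚ
    switched i = pathSign u i ◃ d i

    switched-pair : ∀ c a b s t →
      pathSign u c *ˢ sgn G (u a) (u c) ≡ s *ˢ pathSign u a →
      pathSign u c *ˢ sgn G (u b) (u c) ≡ t *ˢ pathSign u b →
      sgn G (u a) (u c) ◃ d a +ℚ sgn G (u b) (u c) ◃ d b ≡ 0ℚ →
      s ◃ switched a +ℚ t ◃ switched b ≡ 0ℚ
    switched-pair c a b s t sa sb column≡0 = begin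
      s ◃ τ a ◃ d a +ℚ t ◃ τ b ◃ d b                  ≡⟨ cong₂ _+ℚ_ (◃-◃ s (τ a) (d a)) (◃-◃ t (τ b) (d b)) ⟩
      (s *ˢ τ a) ◃ d a +ℚ (t *ˢ τ b) ◃ d b            ≡⟨ cong₂ _+ℚ_ (cong (_◃ d a) (sym sa)) (cong (_◃ d b) (sym sb)) ⟩
      (τ c *ˢ σa) ◃ d a +ℚ (τ c *ˢ σb) ◃ d b          ≡⟨ cong₂ _+ℚ_ (◃-◃ (τ c) σa (d a)) (◃-◃ (τ c) σb (d b)) ⟨
      τ c ◃ σa ◃ d a +ℚ τ c ◃ σb ◃ d b                ≡⟨ ◃-distrib-+ (τ c) _ _ ⟨
      τ c ◃ (σa ◃ d a +ℚ σb ◃ d b)                    ≡⟨ cong (τ c ◃_) column≡0 ⟩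
      τ c ◃ 0ℚ                                        ≡⟨ ◃-zero (τ c) ⟩
      0ℚ                                              ∎
      where
      open ≡-Reasoning
      τ : ℕ → Sign
      τ = pathSign u
      σa σb : Sign
      σa = sgn G (u a) (u c)
      σb = sgn G (u b) (u c)

    switched-step : ∀ j →
      sgn G (u j) (u (suc j)) ◃ d j +ℚ sgn G (u (suc (suc j))) (u (suc j)) ◃ d (suc (suc j)) ≡ 0ℚ →
      switched j +ℚ switched (suc (suc j)) ≡ 0ℚ
    switched-step j = switched-pair (suc j) j (suc (suc j)) Sign.+ Sign.+
      ([s*t]*t≡s (pathSign u j) _)
      (cong (pathSign u (suc j) *ˢ_) (sgn-sym G _ _))

    switched≡0⇒≡0 : ∀ {i} → switched i ≡ 0ℚ → d i ≡ 0ℚ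
    switched≡0⇒≡0 {i} = s◃x≡0⇒x≡0 (pathSign u i)

    ≡0⇒switched≡0 : ∀ {i} → d i ≡ 0ℚ → switched i ≡ 0ℚ
    ≡0⇒switched≡0 {i} di≡0 = trans (cong (pathSign u i ◃_) di≡0) (◃-zero (pathSign u i))

  record InducedPath (k : ℕ) (u : ℕ → Fin n) : Set where
    field
      adjacent    : ∀ i → suc i < k → Adjacent G (u i) (u (suc i))
      nonadjacent : ∀ i j → suc i < j → j < k → Nonadjacent (u i) (u j)

    apart⇒nonadjacent : ∀ i j → i < k → j < k → suc i ≢ j → suc j ≢ i → Nonadjacent (u i) (u j)
    apart⇒nonadjacent i j i<k j<k 1+i≢j 1+j≢i with <-cmp i j
    ... | tri< i<j _ _  = nonadjacent i j (≤∧≢⇒< i<j 1+i≢j) j<k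
    ... | tri≈ _ refl _ = adj-irrefl G (u i)
    ... | tri> _ _ j<i  = Nonadjacent-sym (nonadjacent j i (≤∧≢⇒< j<i 1+j≢i) i<k)

  InducedPath-prepend : ∀ {k u y} → InducedPath k u → Adjacent G y (u 0) → (∀ i → 0 < i → i < k → Nonadjacent y (u i)) →
                        InducedPath (suc k) (prepend y u)
  InducedPath-prepend {k} {u} {y} path y~u0 y≁u = record { adjacent = adjacent′ ; nonadjacent = nonadjacent′ }
    where
    open InducedPath path
    adjacent′ : ∀ i → suc i < suc k → Adjacent G (prepend y u i) (prepend y u (suc i))
    adjacent′ zero    _           = y~u0
    adjacent′ (suc i) (s<s 1+i<k) = adjacent i 1+i<k
    nonadjacent′ : ∀ i j → suc i < j → j < suc k → Nonadjacent (prepend y u i) (prepend y u j)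
    nonadjacent′ zero    (suc j) (s<s 0<j)   (s<s j<k) = y≁u j 0<j j<k
    nonadjacent′ (suc i) (suc j) (s<s 1+i<j) (s<s j<k) = nonadjacent i j 1+i<j j<k

  inducedPath-nonsingular : ∀ h {u} → InducedPath (suc (suc (h + h))) u →
                            NonsingularOn (adjMatrix G) (suc (suc (h + h))) u
  inducedPath-nonsingular h {u} path d column≡0 i i<k = switched≡0⇒≡0 (switched≡0 i i<k)
    where
    open InducedPath path
    open Switching u d
    k : ℕ
    k = suc (suc (h + h))

    middle : ∀ j → suc (suc j) < k → switched j +ℚ switched (suc (suc j)) ≡ 0ℚ
    middle j 2+j<k = switched-step j (trans (sym (column-pair k u d (suc j) j (suc (suc j)) j<k 2+j<k (λ ())
      (adjacent j 1+j<k) (Adjacent-sym (adjacent (suc j) 2+j<k))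
      λ i i<k i≢j i≢2+j → apart⇒nonadjacent i (suc j) i<k 1+j<k (i≢j ∘ suc-injective) (i≢2+j ∘ sym)))
      (column≡0 (suc j) 1+j<k))
      where
      1+j<k : suc j < k
      1+j<k = <-trans (n<1+n _) 2+j<k
      j<k : j < k
      j<k = <-trans (n<1+n _) 1+j<k

    first : switched 1 ≡ 0ℚ
    first = ≡0⇒switched≡0 (s◃x≡0⇒x≡0 (sgn G (u 1) (u 0)) (trans (sym column) (column≡0 0 z<s)))
      where
      column : ∑< k (λ i → d i *ℚ adjMatrix G (u i) (u 0)) ≡ sgn G (u 1) (u 0) ◃ d 1
      column = column-single k u d 0 1 (s<s z<s) (Adjacent-sym (adjacent 0 (s<s z<s)))
        λ i i<k i≢1 → apart⇒nonadjacent i 0 i<k z<s (λ ()) (i≢1 ∘ sym)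

    last : switched (h + h) ≡ 0ℚ
    last = ≡0⇒switched≡0 (s◃x≡0⇒x≡0 (sgn G (u (h + h)) (u L)) (trans (sym column) (column≡0 L ≤-refl)))
      where
      L : ℕ
      L = suc (h + h)
      column : ∑< k (λ i → d i *ℚ adjMatrix G (u i) (u L)) ≡ sgn G (u (h + h)) (u L) ◃ d (h + h)
      column = column-single k u d (suc (h + h)) (h + h) (<-trans (n<1+n _) (n<1+n _)) (adjacent (h + h) ≤-refl)
        λ i i<k i≢2h → apart⇒nonadjacent i (suc (h + h)) i<k ≤-refl (i≢2h ∘ suc-injective) λ { refl → <-irrefl refl i<k }

    switched0≡0 : switched 0 ≡ 0ℚ
    switched0≡0 = s◃x≡0⇒x≡0 (alternating h) (trans (sym (alternation k switched middle 0 h (<-trans (n<1+n _) (n<1+n _)))) last)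

    switched≡0 : ∀ i → i < k → switched i ≡ 0ℚ
    switched≡0 = alternation-zero k switched middle switched0≡0 first

  record ClosedWalk (m : ℕ) (w : ℕ → Fin n) : Set where
    field
      adjacent : ∀ i → i < m → Adjacent G (w i) (w (suc i))
      closing  : Adjacent G (w m) (w 0)

  record CycleSeq (m : ℕ) (w : ℕ → Fin n) : Set where
    field
      injective  : InjectiveOn (suc m) w
      closedWalk : ClosedWalk m w

    open ClosedWalk closedWalk public

  Chordless : ℕ → (ℕ → Fin n) → Set
  Chordless m w = ∀ i j → suc i < j → j ≤ m → ¬ (i ≡ 0 × j ≡ m) → Nonadjacent (w i) (w j)

  Chordless⇒nonadjacent : ∀ {m w} → Chordless m w →
                          ∀ i j → i ≤ m → j ≤ m → ¬ CycleNeighbours m i j → Nonadjacent (w i) (w j)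
  Chordless⇒nonadjacent {m} {w} chordless i j i≤m j≤m ¬i~j with <-cmp i j
  ... | tri< i<j _ _  = chordless i j (≤∧≢⇒< i<j (¬i~j ∘ inj₁)) j≤m
                          λ (i≡0 , j≡m) → ¬i~j (inj₂ (inj₂ (inj₂ (j≡m , i≡0))))
  ... | tri≈ _ refl _ = adj-irrefl G (w i)
  ... | tri> _ _ j<i  = Nonadjacent-sym (chordless j i (≤∧≢⇒< j<i (¬i~j ∘ inj₂ ∘ inj₁)) i≤m
                          λ (j≡0 , i≡m) → ¬i~j (inj₂ (inj₂ (inj₁ (i≡m , j≡0)))))

  chordless⇒inducedPath : ∀ {m w} → ClosedWalk m w → Chordless m w → InducedPath m w
  chordless⇒inducedPath cycle chordless = record
    { adjacent    = λ i 1+i<m → adjacent i (<⇒≤ 1+i<m)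
    ; nonadjacent = λ i j 1+i<j j<m → chordless i j 1+i<j (<⇒≤ j<m) λ (_ , j≡m) → <-irrefl j≡m j<m
    }
    where open ClosedWalk cycle

  cycleSignSeq : (ℕ → Fin n) → ℕ → Sign
  cycleSignSeq w m = pathSign w m *ˢ sgn G (w m) (w 0)

  module CycleEquations {p w} (cycle : ClosedWalk (suc p) w) (chordless : Chordless (suc p) w) (p≢0 : p ≢ 0)
    (d : ℕ → ℚ) (column≡0 : ∀ j → j < suc (suc p) → ∑< (suc (suc p)) (λ i → d i *ℚ adjMatrix G (w i) (w j)) ≡ 0ℚ) where

    open ClosedWalk cycle
    open Switching w d public

    private
      nonadjacent : ∀ i j → i ≤ suc p → j ≤ suc p → ¬ CycleNeighbours (suc p) i j → Nonadjacent (w i) (w j)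
      nonadjacent = Chordless⇒nonadjacent chordless
      m k : ℕ
      m = suc p
      k = suc m
      τ : ℕ → Sign
      τ = pathSign w

    σ : Sign
    σ = cycleSignSeq w m

    middle : ∀ j → suc (suc j) < k → switched j +ℚ switched (suc (suc j)) ≡ 0ℚ
    middle j (s<s 2+j≤m) = switched-step j (trans (sym (column-pair k w d (suc j) j (suc (suc j)) j<k (s<s 2+j≤m) (λ ())
      (adjacent j (<-trans (n<1+n _) 2+j≤m)) (Adjacent-sym (adjacent (suc j) 2+j≤m))
      λ i i<k i≢j i≢2+j → nonadjacent i (suc j) (≤-pred i<k) (<⇒≤ 2+j≤m) λ
        { (inj₁ 1+i≡1+j)                 → i≢j (suc-injective 1+i≡1+j)
        ; (inj₂ (inj₁ 2+j≡i))            → i≢2+j (sym 2+j≡i)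
        ; (inj₂ (inj₂ (inj₁ (_ , ()))))
        ; (inj₂ (inj₂ (inj₂ (1+j≡m , _)))) → <-irrefl 1+j≡m 2+j≤m }))
      (column≡0 (suc j) (<-trans (n<1+n _) (s<s 2+j≤m))))
      where
      j<k : j < k
      j<k = <-trans (n<1+n _) (<-trans (n<1+n _) (s<s 2+j≤m))

    first : switched 1 +ℚ σ ◃ switched m ≡ 0ℚ
    first = switched-pair 0 1 m Sign.+ σ (sgn-sym G _ _) (sym ([t*s]*t≡s _ (τ m)))
      (trans (sym (column-pair k w d 0 1 m (s<s z<s) ≤-refl (p≢0 ∘ sym ∘ suc-injective)
        (Adjacent-sym (adjacent 0 z<s)) closing
        λ i i<k i≢1 i≢m → nonadjacent i 0 (≤-pred i<k) z≤n λ
          { (inj₁ ())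
          ; (inj₂ (inj₁ 1≡i))            → i≢1 (sym 1≡i)
          ; (inj₂ (inj₂ (inj₁ (i≡m , _)))) → i≢m i≡m
          ; (inj₂ (inj₂ (inj₂ (() , _)))) }))
      (column≡0 0 z<s))

    last : switched p +ℚ σ ◃ switched 0 ≡ 0ℚ
    last = switched-pair m p 0 Sign.+ σ ([s*t]*t≡s (τ p) _)
      (trans (cong (τ m *ˢ_) (sgn-sym G _ _)) (sym (Sign.*-identityʳ σ)))
      (trans (sym (column-pair k w d m p 0 (<-trans (n<1+n _) ≤-refl) z<s p≢0
        (adjacent p ≤-refl) (Adjacent-sym closing)
        λ i i<k i≢p i≢0 → nonadjacent i m (≤-pred i<k) ≤-refl λ
          { (inj₁ 1+i≡m)                → i≢p (suc-injective 1+i≡m)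
          ; (inj₂ (inj₁ refl))          → <-irrefl refl i<k
          ; (inj₂ (inj₂ (inj₁ (_ , ()))))
          ; (inj₂ (inj₂ (inj₂ (_ , i≡0)))) → i≢0 i≡0 }))
      (column≡0 m ≤-refl))

  inducedCycle-odd-nonsingular : ∀ h {w} → ClosedWalk (suc (suc (h + h))) w → Chordless (suc (suc (h + h))) w →
    NonsingularOn (adjMatrix G) (suc (suc (suc (h + h)))) w
  inducedCycle-odd-nonsingular h cycle chordless d column≡0 =
    λ i i<k → switched≡0⇒≡0 (alternation-zero k switched middle e0≡0 e1≡0 i i<k)
    where
    open CycleEquations cycle chordless (λ ()) d column≡0
    k : ℕ
    k = suc (suc (suc (h + h)))
    e : ℕ → ℚ
    e = switched
    a : Sign
    a = alternating h

    e[2h]≡a◃e0 : e (h + h) ≡ a ◃ e 0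
    e[2h]≡a◃e0 = alternation k e middle 0 h (<-trans (n<1+n _) (<-trans (n<1+n _) (n<1+n _)))

    e[2h+1]≡a◃e1 : e (suc (h + h)) ≡ a ◃ e 1
    e[2h+1]≡a◃e1 = alternation k e middle 1 h (<-trans (n<1+n _) (n<1+n _))

    e1≡[-σ*-a]◃e0 : e 1 ≡ (opposite σ *ˢ opposite a) ◃ e 0
    e1≡[-σ*-a]◃e0 = begin
      e 1                                      ≡⟨ x+s◃y≡0⇒x≡-s◃y σ _ first ⟩
      opposite σ ◃ e (suc (suc (h + h)))       ≡⟨ cong (opposite σ ◃_) (ℚ-Group.inverseʳ-unique _ _ (middle (h + h) ≤-refl)) ⟩
      opposite σ ◃ - e (h + h)                 ≡⟨ cong (λ x → opposite σ ◃ - x) e[2h]≡a◃e0 ⟩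
      opposite σ ◃ - (a ◃ e 0)                 ≡⟨ cong (opposite σ ◃_) (neg-◃ a (e 0)) ⟩
      opposite σ ◃ opposite a ◃ e 0            ≡⟨ ◃-◃ (opposite σ) (opposite a) (e 0) ⟩
      (opposite σ *ˢ opposite a) ◃ e 0         ∎
      where open ≡-Reasoning

    e1≡[a*-σ]◃e0 : e 1 ≡ (a *ˢ opposite σ) ◃ e 0
    e1≡[a*-σ]◃e0 = begin
      e 1                                      ≡⟨ ◃-involutive a (e 1) ⟨
      a ◃ a ◃ e 1                              ≡⟨ cong (a ◃_) (x+s◃y≡0⇒x≡-s◃y σ _ (subst (λ x → x +ℚ σ ◃ e 0 ≡ 0ℚ) e[2h+1]≡a◃e1 last)) ⟩
      a ◃ opposite σ ◃ e 0                     ≡⟨ ◃-◃ a (opposite σ) (e 0) ⟩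
      (a *ˢ opposite σ) ◃ e 0                  ∎
      where open ≡-Reasoning

    e0≡0 : e 0 ≡ 0ℚ
    e0≡0 = s◃x≡opposite[s]◃x⇒x≡0 (a *ˢ opposite σ) (begin
      (a *ˢ opposite σ) ◃ e 0                  ≡⟨ e1≡[a*-σ]◃e0 ⟨
      e 1                                      ≡⟨ e1≡[-σ*-a]◃e0 ⟩
      (opposite σ *ˢ opposite a) ◃ e 0         ≡⟨ cong (_◃ e 0) (s*opposite[t]≡opposite[s*t] (opposite σ) a) ⟩
      opposite (opposite σ *ˢ a) ◃ e 0         ≡⟨ cong (λ s → opposite s ◃ e 0) (Sign.*-comm (opposite σ) a) ⟩
      opposite (a *ˢ opposite σ) ◃ e 0         ∎)
      where open ≡-Reasoning

    e1≡0 : e 1 ≡ 0ℚ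
    e1≡0 = trans e1≡[a*-σ]◃e0 (trans (cong ((a *ˢ opposite σ) ◃_) e0≡0) (◃-zero (a *ˢ opposite σ)))

  inducedCycle-even-nonsingular : ∀ h {w} → ClosedWalk (suc (h + h)) w → Chordless (suc (h + h)) w → h + h ≢ 0 →
    alternating h *ˢ cycleSignSeq w (suc (h + h)) ≡ Sign.+ →
    NonsingularOn (adjMatrix G) (suc (suc (h + h))) w
  inducedCycle-even-nonsingular h cycle chordless 2h≢0 a*σ≡+ d column≡0 =
    λ i i<k → switched≡0⇒≡0 (alternation-zero k switched middle e0≡0 e1≡0 i i<k)
    where
    open CycleEquations cycle chordless 2h≢0 d column≡0
    k : ℕ
    k = suc (suc (h + h))
    e : ℕ → ℚ
    e = switched
    a : Sign
    a = alternating h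

    e0≡0 : e 0 ≡ 0ℚ
    e0≡0 = x+x≡0⇒x≡0 (begin
      e 0 +ℚ e 0                          ≡⟨ cong (λ s → e 0 +ℚ s ◃ e 0) a*σ≡+ ⟨
      e 0 +ℚ (a *ˢ σ) ◃ e 0               ≡⟨ cong₂ _+ℚ_ (◃-involutive a (e 0)) (◃-◃ a σ (e 0)) ⟨
      a ◃ a ◃ e 0 +ℚ a ◃ σ ◃ e 0          ≡⟨ ◃-distrib-+ a _ _ ⟨
      a ◃ (a ◃ e 0 +ℚ σ ◃ e 0)            ≡⟨ cong (λ x → a ◃ (x +ℚ σ ◃ e 0)) (alternation k e middle 0 h (<-trans (n<1+n _) (n<1+n _))) ⟨
      a ◃ (e (h + h) +ℚ σ ◃ e 0)          ≡⟨ cong (a ◃_) last ⟩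
      a ◃ 0ℚ                              ≡⟨ ◃-zero a ⟩
      0ℚ                                  ∎)
      where open ≡-Reasoning

    e1≡0 : e 1 ≡ 0ℚ
    e1≡0 = x+x≡0⇒x≡0 (begin
      e 1 +ℚ e 1                          ≡⟨ cong (λ s → e 1 +ℚ s ◃ e 1) (trans (Sign.*-comm σ a) a*σ≡+) ⟨
      e 1 +ℚ (σ *ˢ a) ◃ e 1               ≡⟨ cong (e 1 +ℚ_) (◃-◃ σ a (e 1)) ⟨
      e 1 +ℚ σ ◃ a ◃ e 1                  ≡⟨ cong (λ x → e 1 +ℚ σ ◃ x) (alternation k e middle 1 h (n<1+n _)) ⟨
      e 1 +ℚ σ ◃ e (suc (h + h))          ≡⟨ first ⟩
      0ℚ                                  ∎)
      where open ≡-Reasoning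

  -- Shortest cycles

  NoShorterCycle : ℕ → Set
  NoShorterCycle m = ∀ m′ → Cycle G m′ → m ≤ m′

  Cycle→CycleSeq : ∀ {m} (c : Cycle G m) → CycleSeq m (toSeq (Cycle.vert c))
  Cycle→CycleSeq {m} c = record
    { injective = λ i j i<k j<k wi≡wj → trans (sym (Fin.toℕ-fromℕ< i<k))
        (trans (cong toℕ (inj (trans (sym (toSeq-fromℕ< vert i<k)) (trans wi≡wj (toSeq-fromℕ< vert j<k)))))
               (Fin.toℕ-fromℕ< j<k))
    ; closedWalk = record
      { adjacent = λ i i<m → subst₂ (Adjacent G)
        (toSeq-at vert (inject₁ (fromℕ< i<m)) (trans (Fin.toℕ-inject₁ _) (Fin.toℕ-fromℕ< i<m)))
        (toSeq-at vert (suc (fromℕ< i<m)) (cong suc (Fin.toℕ-fromℕ< i<m)))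
          (step (fromℕ< i<m))
      ; closing  = subst₂ (Adjacent G) (toSeq-at vert (fromℕ m) (Fin.toℕ-fromℕ m)) (toSeq-at vert zero refl) close
      }
    }
    where open Cycle c

  CycleSeq→Cycle : ∀ {m w} → 2 ≤ m → CycleSeq m w → Cycle G m
  CycleSeq→Cycle {m} {w} 2≤m cycle = record
    { len≥3 = 2≤m
    ; vert  = λ x → w (toℕ x)
    ; inj   = λ {x} {y} wx≡wy → Fin.toℕ-injective (injective _ _ (Fin.toℕ<n x) (Fin.toℕ<n y) wx≡wy)
    ; step  = λ i → subst (λ j → Adjacent G (w j) (w (suc (toℕ i)))) (sym (Fin.toℕ-inject₁ i)) (adjacent (toℕ i) (Fin.toℕ<n i))
    ; close = subst (λ j → Adjacent G (w j) (w 0)) (sym (Fin.toℕ-fromℕ m)) closing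
    }
    where open CycleSeq cycle

  subcycle : ∀ {m w} → CycleSeq m w → ∀ i l → i + l ≤ m → Adjacent G (w (i + l)) (w i) →
             CycleSeq l (λ t → w (i + t))
  subcycle {m} {w} cycle i l i+l≤m chord = record
    { injective = λ a b a<1+l b<1+l wa≡wb →
        +-cancelˡ-≡ i a b (injective (i + a) (i + b) (inside (≤-pred a<1+l)) (inside (≤-pred b<1+l)) wa≡wb)
    ; closedWalk = record
      { adjacent = λ t t<l → subst (λ x → Adjacent G (w (i + t)) (w x)) (sym (+-suc i t))
          (adjacent (i + t) (subst (_≤ m) (+-suc i t) (≤-trans (+-monoʳ-≤ i t<l) i+l≤m)))
      ; closing  = subst (λ x → Adjacent G (w (i + l)) (w x)) (sym (+-identityʳ i)) chord
      }
    }
    where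
    open CycleSeq cycle
    inside : ∀ {a} → a ≤ l → i + a < suc m
    inside a≤l = s≤s (≤-trans (+-monoʳ-≤ i a≤l) i+l≤m)

  shortest⇒chordless : ∀ {m w} → CycleSeq m w → NoShorterCycle m → Chordless m w
  shortest⇒chordless {m} {w} cycle shortest i j 2+i≤j j≤m not-closing =
    subst (λ x → Nonadjacent (w i) (w x)) i+l≡j
      (no-chord (j ∸ i) (m+n≤o⇒m≤o∸n 2 2+i≤j) (subst (_≤ m) (sym i+l≡j) j≤m)
        λ (i≡0 , i+l≡m) → not-closing (i≡0 , trans (sym i+l≡j) i+l≡m))
    where
    i+l≡j : i + (j ∸ i) ≡ j
    i+l≡j = m+[n∸m]≡n (<⇒≤ (<⇒≤ 2+i≤j))
    no-chord : ∀ l → 2 ≤ l → i + l ≤ m → ¬ (i ≡ 0 × i + l ≡ m) → Nonadjacent (w i) (w (i + l))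
    no-chord l 2≤l i+l≤m not-closing′ with adj G (w i) (w (i + l)) in chord | l <? m
    ... | false | _       = refl
    ... | true  | yes l<m = ⊥-elim (<-irrefl refl (<-≤-trans l<m
                              (shortest l (CycleSeq→Cycle 2≤l (subcycle cycle i l i+l≤m (Adjacent-sym chord))))))
    ... | true  | no  l≮m = ⊥-elim (not-closing′ (i≡0 , cong₂ _+_ i≡0 l≡m))
      where
      i≡0 : i ≡ 0
      i≡0 = n≤0⇒n≡0 (+-cancelʳ-≤ l i 0 (≤-trans i+l≤m (≮⇒≥ l≮m)))
      l≡m : l ≡ m
      l≡m = ≤-antisym (≤-trans (m≤n+m l i) i+l≤m) (≮⇒≥ l≮m)

  rotate₁-CycleSeq : ∀ {m w} → 0 < m → CycleSeq m w → CycleSeq m (rotate₁ m w)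
  rotate₁-CycleSeq {m} {w} 0<m cycle = record
    { injective = inj ; closedWalk = record { adjacent = adj′ ; closing = closing′ } }
    where
    open CycleSeq cycle
    ≮⇒≡m : ∀ {i} → i < suc m → ¬ i < m → i ≡ m
    ≮⇒≡m i<1+m i≮m = ≤-antisym (≤-pred i<1+m) (≮⇒≥ i≮m)
    inj : InjectiveOn (suc m) (rotate₁ m w)
    inj i j i<k j<k eq with i <? m | j <? m
    ... | yes i<m | yes j<m = suc-injective (injective _ _ (s<s i<m) (s<s j<m) eq)
    ... | yes i<m | no  _   with injective _ _ (s<s i<m) z<s eq
    ...   | ()
    inj i j i<k j<k eq | no _ | yes j<m with injective _ _ (s<s j<m) z<s (sym eq)
    ...   | ()
    inj i j i<k j<k eq | no i≮m | no j≮m = trans (≮⇒≡m i<k i≮m) (sym (≮⇒≡m j<k j≮m))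
    adj′ : ∀ i → i < m → Adjacent G (rotate₁ m w i) (rotate₁ m w (suc i))
    adj′ i i<m rewrite rotate₁-< m w i<m with suc i <? m
    ... | yes 1+i<m = adjacent (suc i) 1+i<m
    ... | no  1+i≮m = subst (λ x → Adjacent G (w x) (w 0)) (sym (≤-antisym i<m (≮⇒≥ 1+i≮m))) closing
    closing′ : Adjacent G (rotate₁ m w m) (rotate₁ m w 0)
    closing′ rewrite rotate₁-last m w | rotate₁-< m w 0<m = adjacent 0 0<m

  rotate-CycleSeq : ∀ {m} r {w} → 0 < m → CycleSeq m w → CycleSeq m (rotate m r w)
  rotate-CycleSeq zero    0<m cycle = cycle
  rotate-CycleSeq (suc r) 0<m cycle = rotate-CycleSeq r 0<m (rotate₁-CycleSeq 0<m cycle)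

  reflect-CycleSeq : ∀ {m w} → 0 < m → CycleSeq m w → CycleSeq m (reflect m w)
  reflect-CycleSeq {m@(suc m′)} {w} _ cycle = record
    { injective = inj ; closedWalk = record { adjacent = adj′ ; closing = closing′ } }
    where
    open CycleSeq cycle
    ∸-inside : ∀ t → m ∸ t < suc m
    ∸-inside t = s≤s (m∸n≤m m t)
    inj : InjectiveOn (suc m) (reflect m w)
    inj zero    zero    _         _         _  = refl
    inj zero    (suc j) _         (s<s j<m) eq = ⊥-elim (m>n⇒m∸n≢0 j<m (sym (injective _ _ z<s (∸-inside j) eq)))
    inj (suc i) zero    (s<s i<m) _         eq = ⊥-elim (m>n⇒m∸n≢0 i<m (injective _ _ (∸-inside i) z<s eq))
    inj (suc i) (suc j) (s<s i<m) (s<s j<m) eq =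
      cong suc (∸-cancelˡ-≡ (<⇒≤ i<m) (<⇒≤ j<m) (injective _ _ (∸-inside i) (∸-inside j) eq))
    adj′ : ∀ i → i < m → Adjacent G (reflect m w i) (reflect m w (suc i))
    adj′ zero    _     = Adjacent-sym closing
    adj′ (suc t) 1+t<m = subst (λ x → Adjacent G (w x) (w (m ∸ suc t))) (sym (+-∸-assoc 1 (<⇒≤ 1+t<m)))
      (Adjacent-sym (adjacent (m ∸ suc t) (∸-monoʳ-< z<s (<⇒≤ 1+t<m))))
    closing′ : Adjacent G (reflect m w m) (reflect m w 0)
    closing′ = subst (λ x → Adjacent G (w x) (w 0)) (sym (m+n∸n≡m 1 m′)) (Adjacent-sym (adjacent 0 z<s))

  detour-length : ∀ {m w y} → CycleSeq m w → NoShorterCycle m → Outside m w y → Adjacent G y (w 0) →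
                  ∀ t → 0 < t → t ≤ m → Adjacent G y (w t) → m ≤ suc t
  detour-length {m} {w} {y} cycle shortest out y~w0 t 0<t t≤m y~wt =
    shortest (suc t) (CycleSeq→Cycle (s≤s 0<t) detour)
    where
    open CycleSeq cycle
    detour : CycleSeq (suc t) (prepend y w)
    detour = record
      { injective = prepend-injective (InjectiveOn-≤ (s≤s t≤m) injective) (Outside-≤ t≤m out)
      ; closedWalk = record
        { adjacent = λ { zero _ → y~w0 ; (suc s) (s<s s<t) → adjacent s (<-≤-trans s<t t≤m) }
        ; closing  = Adjacent-sym y~wt
        }
      }

  -- The detours y, w 0, …, w t and y, w t, …, w m, w 0 through a second neighbour w t of y
  -- would both be cycles of length at least m + 1, forcing m ≤ 3.
  pendant-nonadjacent : ∀ {m w y} → CycleSeq m w → NoShorterCycle m → 3 < m → Outside m w y → Adjacent G y (w 0) →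
                        ∀ t → 0 < t → t ≤ m → Nonadjacent y (w t)
  pendant-nonadjacent {m} {w} {y} cycle shortest 3<m out y~w0 t 0<t t≤m with adj G y (w t) in y~wt
  ... | false = refl
  ... | true  = ⊥-elim (≤⇒≯ (≤-trans m≤2+[m∸t] (s≤s (s≤s m∸t≤1))) 3<m)
    where
    0<m : 0 < m
    0<m = <-≤-trans 0<t t≤m
    m∸t≤1 : m ∸ t ≤ 1
    m∸t≤1 = subst (m ∸ t ≤_) (m+n∸n≡m 1 t)
      (∸-monoˡ-≤ t (detour-length cycle shortest out y~w0 t 0<t t≤m y~wt))
    m≤2+[m∸t] : m ≤ suc (suc (m ∸ t))
    m≤2+[m∸t] = detour-length (reflect-CycleSeq 0<m cycle) shortest (Outside-reflect out) y~w0
      (suc (m ∸ t)) z<s (∸-monoʳ-< 0<t t≤m)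
      (subst (Adjacent G y) (sym (reflect-suc[m∸t] m w t≤m)) y~wt)

  -- Balance

  cycleSign≡cycleSignSeq : ∀ {m} (c : Cycle G m) → cycleSign G c ≡ cycleSignSeq (toSeq (Cycle.vert c)) m
  cycleSign≡cycleSignSeq {m} c = begin
    foldr _*ˢ_ z (map F (allFin m))                  ≡⟨ cong (foldr _*ˢ_ z) (map-tabulate (λ i → i) F) ⟩
    foldr _*ˢ_ z (tabulate F)                        ≡⟨ cong (foldr _*ˢ_ z) (tabulate-cong F≗s) ⟩
    foldr _*ˢ_ z (tabulate {n = m} (λ i → s (toℕ i)))  ≡⟨ foldr-tabulate-signProduct m s z ⟩
    signProduct s m *ˢ z                             ≡⟨ cong (signProduct s m *ˢ_) (cong₂ (sgn G) (toSeq-at vert (fromℕ m) (Fin.toℕ-fromℕ m)) (toSeq-at vert zero refl)) ⟩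
    cycleSignSeq w m                                 ∎
    where
    open Cycle c
    open ≡-Reasoning
    w : ℕ → Fin n
    w = toSeq vert
    z : Sign
    z = sgn G (vert (fromℕ m)) (vert zero)
    F : Fin m → Sign
    F i = sgn G (vert (inject₁ i)) (vert (suc i))
    s : ℕ → Sign
    s j = sgn G (w j) (w (suc j))
    F≗s : ∀ i → F i ≡ s (toℕ i)
    F≗s i = cong₂ (sgn G) (toSeq-at vert (inject₁ i) (Fin.toℕ-inject₁ i)) (toSeq-at vert (suc i) refl)

  pathSign-potential : ∀ (φ : Fin n → Sign) {m w} → (∀ i → i < m → sgn G (w i) (w (suc i)) ≡ φ (w i) *ˢ φ (w (suc i))) →
                       ∀ i → i ≤ m → pathSign w i ≡ φ (w 0) *ˢ φ (w i)
  pathSign-potential φ {w = w} pot zero    _     = sym (Sign.s*s≡+ (φ (w 0)))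
  pathSign-potential φ {w = w} pot (suc i) 1+i≤m = begin
    pathSign w i *ˢ sgn G (w i) (w (suc i))                     ≡⟨ cong₂ _*ˢ_ (pathSign-potential φ pot i (<⇒≤ 1+i≤m)) (pot i 1+i≤m) ⟩
    (φ (w 0) *ˢ φ (w i)) *ˢ (φ (w i) *ˢ φ (w (suc i)))          ≡⟨ [s*t]*[t*u]≡s*u (φ (w 0)) (φ (w i)) (φ (w (suc i))) ⟩
    φ (w 0) *ˢ φ (w (suc i))                                    ∎
    where open ≡-Reasoning

  balanced-potential : (φ : Fin n → Sign) → (∀ u v → Adjacent G u v → sgn G u v ≡ φ u *ˢ φ v) → Balanced G
  balanced-potential φ pot m c = begin
    cycleSign G c                                       ≡⟨ cycleSign≡cycleSignSeq c ⟩
    pathSign w m *ˢ sgn G (w m) (w 0)                   ≡⟨ cong₂ _*ˢ_ (pathSign-potential φ (λ i i<m → pot _ _ (adjacent i i<m)) m ≤-refl) (pot _ _ closing) ⟩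
    (φ (w 0) *ˢ φ (w m)) *ˢ (φ (w m) *ˢ φ (w 0))        ≡⟨ [s*t]*[t*u]≡s*u (φ (w 0)) (φ (w m)) (φ (w 0)) ⟩
    φ (w 0) *ˢ φ (w 0)                                  ≡⟨ Sign.s*s≡+ (φ (w 0)) ⟩
    Sign.+                                              ∎
    where
    open ≡-Reasoning
    open CycleSeq (Cycle→CycleSeq c)
    w : ℕ → Fin n
    w = toSeq (Cycle.vert c)

  adjacent⇒CycleNeighbours : ∀ {m w} → Chordless m w → ∀ {i j} → i ≤ m → j ≤ m →
                             Adjacent G (w i) (w j) → CycleNeighbours m i j
  adjacent⇒CycleNeighbours {m} chordless {i} {j} i≤m j≤m wi~wj = decidable-stable (CycleNeighbours? m i j)
    λ ¬i~j → Adjacent⇒¬Nonadjacent wi~wj (Chordless⇒nonadjacent chordless i j i≤m j≤m ¬i~j)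

  module Spanning {m} (c : Cycle G m) (shortest : NoShorterCycle m) (spans : ∀ x → ∃ λ i → Cycle.vert c i ≡ x) where

    open Cycle c

    private
      w : ℕ → Fin n
      w = toSeq vert
      τ : ℕ → Sign
      τ = pathSign w

      index : Fin n → ℕ
      index x = toℕ (proj₁ (spans x))

      index≤m : ∀ x → index x ≤ m
      index≤m x = ≤-pred (Fin.toℕ<n (proj₁ (spans x)))

      w-index : ∀ x → w (index x) ≡ x
      w-index x = trans (toSeq-toℕ vert (proj₁ (spans x))) (proj₂ (spans x))

      ≡vert : ∀ y (x : Fin (suc m)) → toℕ x ≡ index y → y ≡ vert x
      ≡vert y x x≡y = trans (sym (w-index y)) (trans (cong w (sym x≡y)) (toSeq-toℕ vert x))

      index-neighbours : ∀ {u v} → Adjacent G u v → CycleNeighbours m (index u) (index v)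
      index-neighbours {u} {v} u~v = adjacent⇒CycleNeighbours (shortest⇒chordless (Cycle→CycleSeq c) shortest) (index≤m u) (index≤m v)
        (subst₂ (Adjacent G) (sym (w-index u)) (sym (w-index v)) u~v)

    vertexCount : suc m ≡ n
    vertexCount = ≤-antisym (Fin.injective⇒≤ inj)
      (Fin.injective⇒≤ {f = λ x → proj₁ (spans x)} λ {x} {y} eq →
        trans (sym (proj₂ (spans x))) (trans (cong vert eq) (proj₂ (spans y))))

    cycleEdge : ∀ u v → Adjacent G u v → CycleEdge G c u v
    cycleEdge u v u~v with index-neighbours u~v
    ... | inj₁ 1+iu≡iv = inj₁ (fromℕ< iu<m , inj₁ (≡vert u _ (trans (Fin.toℕ-inject₁ _) (Fin.toℕ-fromℕ< iu<m)) ,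
                                                  ≡vert v _ (trans (cong suc (Fin.toℕ-fromℕ< iu<m)) 1+iu≡iv)))
      where
      iu<m : index u < m
      iu<m = subst (_≤ m) (sym 1+iu≡iv) (index≤m v)
    ... | inj₂ (inj₁ 1+iv≡iu) = inj₁ (fromℕ< iv<m , inj₂ (≡vert v _ (trans (Fin.toℕ-inject₁ _) (Fin.toℕ-fromℕ< iv<m)) ,
                                                        ≡vert u _ (trans (cong suc (Fin.toℕ-fromℕ< iv<m)) 1+iv≡iu)))
      where
      iv<m : index v < m
      iv<m = subst (_≤ m) (sym 1+iv≡iu) (index≤m u)
    ... | inj₂ (inj₂ (inj₁ (iu≡m , iv≡0))) = inj₂ (inj₁ (≡vert u _ (trans (Fin.toℕ-fromℕ m) (sym iu≡m)) , ≡vert v zero (sym iv≡0)))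
    ... | inj₂ (inj₂ (inj₂ (iv≡m , iu≡0))) = inj₂ (inj₂ (≡vert v _ (trans (Fin.toℕ-fromℕ m) (sym iv≡m)) , ≡vert u zero (sym iu≡0)))

    isCycleGraph : IsCycleGraph G
    isCycleGraph = m , c , vertexCount , cycleEdge

    unbalanced : cycleSignSeq w m ≡ Sign.- → Unbalanced G
    unbalanced σ≡- balanced with trans (sym (balanced m c)) (trans (cycleSign≡cycleSignSeq c) σ≡-)
    ... | ()

    balanced : cycleSignSeq w m ≡ Sign.+ → Balanced G
    balanced σ≡+ = balanced-potential (λ x → τ (index x)) λ u v u~v →
      trans (cong₂ (sgn G) (sym (w-index u)) (sym (w-index v))) (switching (index-neighbours u~v))
      where
      switching : ∀ {a b} → CycleNeighbours m a b → sgn G (w a) (w b) ≡ τ a *ˢ τ b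
      switching {a} (inj₁ refl)                  = sym (t*[t*s]≡s _ (τ a))
      switching {b = b} (inj₂ (inj₁ refl))       = trans (sgn-sym G _ _) (sym ([t*s]*t≡s _ (τ b)))
      switching (inj₂ (inj₂ (inj₁ (refl , refl)))) = trans (t*s≡+⇒s≡t σ≡+) (sym (Sign.*-identityʳ (τ m)))
      switching (inj₂ (inj₂ (inj₂ (refl , refl)))) = trans (sgn-sym G _ _) (t*s≡+⇒s≡t σ≡+)

  -- Girth four: with sides given by adjacency to a fixed vertex a, either G is complete bipartite
  -- or one of the pairs violating this yields an induced path on four vertices.
  module GirthFour (connected : Connected G) (shortest : NoShorterCycle 3) where

    triangle-free : ∀ {x y z} → Adjacent G x y → Adjacent G y z → Adjacent G z x → ⊥
    triangle-free {x} {y} {z} x~y y~z z~x = <-irrefl refl (shortest 2 triangle)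
      where
      vert : Fin 3 → Fin n
      vert zero             = x
      vert (suc zero)       = y
      vert (suc (suc zero)) = z
      inj : ∀ {i j} → vert i ≡ vert j → i ≡ j
      inj {zero}             {zero}             _   = refl
      inj {suc zero}         {suc zero}         _   = refl
      inj {suc (suc zero)}   {suc (suc zero)}   _   = refl
      inj {zero}             {suc zero}         x≡y = ⊥-elim (Adjacent⇒≢ x~y x≡y)
      inj {suc zero}         {zero}             y≡x = ⊥-elim (Adjacent⇒≢ x~y (sym y≡x))
      inj {suc zero}         {suc (suc zero)}   y≡z = ⊥-elim (Adjacent⇒≢ y~z y≡z)
      inj {suc (suc zero)}   {suc zero}         z≡y = ⊥-elim (Adjacent⇒≢ y~z (sym z≡y))
      inj {suc (suc zero)}   {zero}             z≡x = ⊥-elim (Adjacent⇒≢ z~x z≡x)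
      inj {zero}             {suc (suc zero)}   x≡z = ⊥-elim (Adjacent⇒≢ z~x (sym x≡z))
      triangle : Cycle G 2
      triangle = record
        { len≥3 = ≤-refl ; vert = vert ; inj = inj
        ; step  = λ { zero → x~y ; (suc zero) → y~z }
        ; close = z~x
        }

    common-neighbour⇒nonadjacent : ∀ {x y z} → Adjacent G x y → Adjacent G y z → Nonadjacent x z
    common-neighbour⇒nonadjacent x~y y~z = ¬Adjacent⇒Nonadjacent λ x~z → triangle-free x~y y~z (Adjacent-sym x~z)

    inducedP4-rank : ∀ {x y z t} → Adjacent G x y → Adjacent G y z → Adjacent G z t →
                     Nonadjacent x z → Nonadjacent x t → Nonadjacent y t → RankAtLeast (adjMatrix G) 4
    inducedP4-rank {x} {y} {z} {t} x~y y~z z~t x≁z x≁t y≁t =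
      rankAtLeast-nonsingular (adjMatrix G) 4 (quad x y z t) (inducedPath-nonsingular 1 xyzt)
      where
      zt : InducedPath 2 (prepend z (λ _ → t))
      zt = record
        { adjacent    = λ { zero _ → z~t ; (suc _) (s<s (s<s ())) }
        ; nonadjacent = λ { _ (suc zero) (s<s ()) _ ; _ (suc (suc _)) _ (s<s (s<s ())) }
        }
      yzt : InducedPath 3 (prepend y (prepend z (λ _ → t)))
      yzt = InducedPath-prepend zt y~z λ { (suc zero) _ _ → y≁t ; (suc (suc _)) _ (s<s (s<s ())) }
      xyzt : InducedPath 4 (quad x y z t)
      xyzt = InducedPath-prepend yzt x~y λ
        { (suc zero) _ _ → x≁z ; (suc (suc zero)) _ _ → x≁t ; (suc (suc (suc _))) _ (s<s (s<s (s<s ()))) }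

    negativeSquare-rank : ∀ {x b a y} → Adjacent G x b → Adjacent G b a → Adjacent G a y → Adjacent G y x →
                          ((sgn G x b *ˢ sgn G b a) *ˢ sgn G a y) *ˢ sgn G y x ≡ Sign.- → RankAtLeast (adjMatrix G) 4
    negativeSquare-rank {x} {b} {a} {y} x~b b~a a~y y~x σ≡- =
      rankAtLeast-nonsingular (adjMatrix G) 4 (quad x b a y)
        (inducedCycle-even-nonsingular 1 square chordless (λ ()) (cong opposite σ≡-))
      where
      square : ClosedWalk 3 (quad x b a y)
      square = record
        { adjacent = λ { 0 _ → x~b ; 1 _ → b~a ; 2 _ → a~y ; (suc (suc (suc _))) (s<s (s<s (s<s ()))) }
        ; closing  = y~x
        }
      chordless : Chordless 3 (quad x b a y)
      chordless 0 2 _ _ _ = common-neighbour⇒nonadjacent x~b b~a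
      chordless 1 3 _ _ _ = common-neighbour⇒nonadjacent b~a a~y
      chordless 0 3 _ _ not-closing = ⊥-elim (not-closing (refl , refl))
      chordless 0 1 (s<s ()) _ _
      chordless 1 1 (s<s ()) _ _
      chordless 1 2 (s<s (s<s ())) _ _
      chordless (suc (suc _)) 1 (s<s ()) _ _
      chordless (suc (suc _)) 2 (s<s (s<s ())) _ _
      chordless (suc (suc _)) 3 (s<s (s<s (s<s ()))) _ _
      chordless _ (suc (suc (suc (suc _)))) _ (s≤s (s≤s (s≤s ()))) _

    WithinTwo : Fin n → Fin n → Set
    WithinTwo a z = z ≡ a ⊎ Adjacent G a z ⊎ ∃ λ x → Adjacent G a x × Adjacent G x z

    WithinTwo? : ∀ a z → Dec (WithinTwo a z)
    WithinTwo? a z = (z Fin.≟ a) ⊎-dec (adj G a z Bool.≟ true) ⊎-dec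
                     Fin.any? (λ x → (adj G a x Bool.≟ true) ×-dec (adj G x z Bool.≟ true))

    far-rank : ∀ a y → ¬ WithinTwo a y → RankAtLeast (adjMatrix G) 4
    far-rank a y far with crossing-edge connected (WithinTwo? a) (inj₁ refl) far
    ... | q , z , near-q , far-z , q~z = rank near-q
      where
      rank : WithinTwo a q → RankAtLeast (adjMatrix G) 4
      rank (inj₁ q≡a)        = ⊥-elim (far-z (inj₂ (inj₁ (subst (λ v → Adjacent G v z) q≡a q~z))))
      rank (inj₂ (inj₁ a~q)) = ⊥-elim (far-z (inj₂ (inj₂ (q , a~q , q~z))))
      rank (inj₂ (inj₂ (x , a~x , x~q))) = inducedP4-rank (Adjacent-sym q~z) (Adjacent-sym x~q) (Adjacent-sym a~x)
        (¬Adjacent⇒Nonadjacent λ z~x → far-z (inj₂ (inj₂ (x , a~x , Adjacent-sym z~x))))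
        (¬Adjacent⇒Nonadjacent λ z~a → far-z (inj₂ (inj₁ (Adjacent-sym z~a))))
        (¬Adjacent⇒Nonadjacent λ q~a → far-z (inj₂ (inj₂ (q , Adjacent-sym q~a , q~z))))

    module _ {a b} (a~b : Adjacent G a b) where

      SplitsByNeighbourhood : Set
      SplitsByNeighbourhood = ∀ u v → adj G u v ≡ adj G a u xor adj G a v

      nonneighbourEdge-rank : ∀ {u v} → Adjacent G u v → Nonadjacent a u → Nonadjacent a v → RankAtLeast (adjMatrix G) 4
      nonneighbourEdge-rank {u} {v} u~v a≁u a≁v with Fin.any? (λ x → (adj G a x Bool.≟ true) ×-dec (adj G x u Bool.≟ true))
      ... | yes (x , a~x , x~u) = inducedP4-rank (Adjacent-sym u~v) (Adjacent-sym x~u) (Adjacent-sym a~x)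
                                    (common-neighbour⇒nonadjacent (Adjacent-sym u~v) (Adjacent-sym x~u))
                                    (Nonadjacent-sym a≁v) (Nonadjacent-sym a≁u)
      ... | no  ¬a~x~u = far-rank a u λ
        { (inj₁ u≡a)                → Adjacent⇒¬Nonadjacent (subst (λ w → Adjacent G w v) u≡a u~v) a≁v
        ; (inj₂ (inj₁ a~u))         → Adjacent⇒¬Nonadjacent a~u a≁u
        ; (inj₂ (inj₂ a~x~u))       → ¬a~x~u a~x~u }

      missingCrossEdge-rank : ∀ {u v} → Nonadjacent u v → Adjacent G a u → Nonadjacent a v → RankAtLeast (adjMatrix G) 4
      missingCrossEdge-rank {u} {v} u≁v a~u a≁v with Fin.any? (λ x → (adj G a x Bool.≟ true) ×-dec (adj G x v Bool.≟ true))
      ... | yes (x , a~x , x~v) = inducedP4-rank (Adjacent-sym x~v) (Adjacent-sym a~x) a~u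
                                    (Nonadjacent-sym a≁v) (Nonadjacent-sym u≁v)
                                    (common-neighbour⇒nonadjacent (Adjacent-sym a~x) a~u)
      ... | no  ¬a~x~v = far-rank a v λ
        { (inj₁ v≡a)                → Adjacent⇒¬Nonadjacent (subst (Adjacent G u) (sym v≡a) (Adjacent-sym a~u)) u≁v
        ; (inj₂ (inj₁ a~v))         → Adjacent⇒¬Nonadjacent a~v a≁v
        ; (inj₂ (inj₂ a~x~v))       → ¬a~x~v a~x~v }

      nonsplit-rank : ∀ u v → adj G u v ≢ adj G a u xor adj G a v → RankAtLeast (adjMatrix G) 4
      nonsplit-rank u v uv≢ with adj G u v in uv | adj G a u in au | adj G a v in av
      ... | true  | true  | true  = ⊥-elim (triangle-free au uv (Adjacent-sym av))
      ... | true  | false | false = nonneighbourEdge-rank uv au av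
      ... | false | true  | false = missingCrossEdge-rank uv au av
      ... | false | false | true  = missingCrossEdge-rank (Nonadjacent-sym uv) av au
      ... | true  | true  | false = ⊥-elim (uv≢ refl)
      ... | true  | false | true  = ⊥-elim (uv≢ refl)
      ... | false | true  | true  = ⊥-elim (uv≢ refl)
      ... | false | false | false = ⊥-elim (uv≢ refl)

      -- φ below is a switching function exactly when all pairs across are consistent; an
      -- inconsistent pair x, y closes the negative 4-cycle x b a y.
      Consistent : Fin n → Fin n → Set
      Consistent x y = sgn G x y ≡ (sgn G x b *ˢ sgn G a y) *ˢ sgn G a b

      split-rank : SplitsByNeighbourhood → ¬ (Balanced G × CompleteBipartite G) → RankAtLeast (adjMatrix G) 4
      split-rank splits ¬balanced-bipartite with Fin.any? (λ x → Fin.any? λ y →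
        (adj G a x Bool.≟ false) ×-dec (adj G a y Bool.≟ true) ×-dec ¬? (sgn G x y Sign.≟ (sgn G x b *ˢ sgn G a y) *ˢ sgn G a b))
      ... | yes (x , y , a≁x , a~y , inconsistent) =
        negativeSquare-rank x~b (Adjacent-sym a~b) a~y y~x (begin
          ((sgn G x b *ˢ sgn G b a) *ˢ sgn G a y) *ˢ sgn G y x   ≡⟨ cong₂ (λ s t → ((sgn G x b *ˢ s) *ˢ sgn G a y) *ˢ t) (sgn-sym G b a) (sgn-sym G y x) ⟩
          ((sgn G x b *ˢ sgn G a b) *ˢ sgn G a y) *ˢ sgn G x y   ≡⟨ cong (_*ˢ sgn G x y) ([s*t]*u≡[s*u]*t (sgn G x b) (sgn G a b) (sgn G a y)) ⟩
          T *ˢ sgn G x y                                         ≡⟨ cong (T *ˢ_) (s≢t⇒s≡opposite[t] inconsistent) ⟩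
          T *ˢ opposite T                                        ≡⟨ Sign.s*opposite[s]≡- T ⟩
          Sign.-                                                 ∎)
        where
        open ≡-Reasoning
        T : Sign
        T = (sgn G x b *ˢ sgn G a y) *ˢ sgn G a b
        x~b : Adjacent G x b
        x~b = trans (splits x b) (cong₂ _xor_ a≁x a~b)
        y~x : Adjacent G y x
        y~x = trans (splits y x) (cong₂ _xor_ a~y a≁x)
      ... | no consistent? =
        ⊥-elim (¬balanced-bipartite (balanced-potential φ potential , adj G a , (b , a~b) , (a , adj-irrefl G a) , splits))
        where
        consistent : ∀ x y → Nonadjacent a x → Adjacent G a y → Consistent x y
        consistent x y a≁x a~y = decidable-stable (sgn G x y Sign.≟ _) λ inconsistent → consistent? (x , y , a≁x , a~y , inconsistent)
        φ : Fin n → Sign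
        φ x with adj G a x
        ... | true  = sgn G a x *ˢ sgn G a b
        ... | false = sgn G x b
        potential : ∀ u v → Adjacent G u v → sgn G u v ≡ φ u *ˢ φ v
        potential u v u~v with adj G a u in au | adj G a v in av | splits u v
        ... | true  | true  | u≁v = ⊥-elim (Adjacent⇒¬Nonadjacent u~v u≁v)
        ... | false | false | u≁v = ⊥-elim (Adjacent⇒¬Nonadjacent u~v u≁v)
        ... | false | true  | _   = trans (consistent u v au av) (Sign.*-assoc (sgn G u b) (sgn G a v) (sgn G a b))
        ... | true  | false | _   = trans (sgn-sym G u v)
                                      (trans (consistent v u av au) ([s*t]*u≡[t*u]*s (sgn G v b) (sgn G a u) (sgn G a b)))

      girthFour-rank : ¬ (Balanced G × CompleteBipartite G) → RankAtLeast (adjMatrix G) 4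
      girthFour-rank ¬balanced-bipartite
        with Fin.any? (λ u → Fin.any? λ v → ¬? (adj G u v Bool.≟ (adj G a u xor adj G a v)))
      ... | yes (u , v , nonsplit) = nonsplit-rank u v nonsplit
      ... | no  splits? = split-rank (λ u v → decidable-stable (adj G u v Bool.≟ _) λ nonsplit → splits? (u , v , nonsplit))
                                     ¬balanced-bipartite

  -- Rank at least the girth

  offCycle-rank : Connected G → ∀ h (c : Cycle G (suc (h + h))) → NoShorterCycle (suc (h + h)) → 3 < suc (h + h) →
                  ∃ (λ x → ∀ i → Cycle.vert c i ≢ x) → RankAtLeast (adjMatrix G) (suc (suc (h + h)))
  offCycle-rank connected h c shortest 3<m (x , x-off)
    with crossing-edge connected (λ v → Fin.all? λ j → ¬? (Cycle.vert c j Fin.≟ v)) x-off (λ v0-off → v0-off zero refl)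
  ... | y , z , y-off , z-on , y~z = rankAtLeast-nonsingular (adjMatrix G) _ (prepend y w′) (inducedPath-nonsingular h path)
    where
    open Cycle c
    m : ℕ
    m = suc (h + h)
    w : ℕ → Fin n
    w = toSeq vert
    z-at : ∃ λ r → vert r ≡ z
    z-at = decidable-stable (Fin.any? λ j → vert j Fin.≟ z) λ none → z-on λ j vj≡z → none (j , vj≡z)
    r : ℕ
    r = toℕ (proj₁ z-at)
    w′ : ℕ → Fin n
    w′ = rotate m r w
    cycle′ : CycleSeq m w′
    cycle′ = rotate-CycleSeq r z<s (Cycle→CycleSeq c)
    y~w′0 : Adjacent G y (w′ 0)
    y~w′0 = subst (Adjacent G y)
      (sym (trans (rotate-zero m r w (≤-pred (Fin.toℕ<n (proj₁ z-at)))) (trans (toSeq-toℕ vert (proj₁ z-at)) (proj₂ z-at))))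
      y~z
    out : Outside m w′ y
    out = Outside-rotate r λ j j≤m wj≡y → y-off (fromℕ< (s≤s j≤m)) (trans (sym (toSeq-fromℕ< vert (s≤s j≤m))) wj≡y)
    path : InducedPath (suc m) (prepend y w′)
    path = InducedPath-prepend (chordless⇒inducedPath (CycleSeq.closedWalk cycle′) (shortest⇒chordless cycle′ shortest)) y~w′0
      λ t 0<t t<m → pendant-nonadjacent cycle′ shortest 3<m out y~w′0 t 0<t (<⇒≤ t<m)

  degenerateEvenCycle-rank : Connected G → ∀ h (c : Cycle G (suc (h + h))) → NoShorterCycle (suc (h + h)) →
    alternating h *ˢ cycleSignSeq (toSeq (Cycle.vert c)) (suc (h + h)) ≢ Sign.+ →
    ¬ (Balanced G × CompleteBipartite G × suc (suc (h + h)) ≡ 4) →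
    ¬ (Balanced G × IsCycleGraph G × suc (suc (h + h)) % 4 ≡ 0) →
    ¬ (Unbalanced G × IsCycleGraph G × suc (suc (h + h)) % 4 ≡ 2) →
    RankAtLeast (adjMatrix G) (suc (suc (h + h)))
  degenerateEvenCycle-rank connected zero c _ _ _ _ _ = ⊥-elim (≤⇒≯ (Cycle.len≥3 c) ≤-refl)
  degenerateEvenCycle-rank connected (suc zero) c shortest _ ¬K _ _ =
    GirthFour.girthFour-rank connected shortest (Cycle.step c zero) λ (balanced , bipartite) → ¬K (balanced , bipartite , refl)
  degenerateEvenCycle-rank connected h@(suc (suc h′)) c shortest degenerate _ ¬C₀ ¬C₂
    with Fin.all? (λ x → Fin.any? λ i → Cycle.vert c i Fin.≟ x)
  ... | yes spans with degenerate-residue h _ degenerate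
  ...   | inj₁ (σ≡+ , residue) = ⊥-elim (¬C₀ (balanced σ≡+ , isCycleGraph , residue))
    where open Spanning c shortest spans
  ...   | inj₂ (σ≡- , residue) = ⊥-elim (¬C₂ (unbalanced σ≡- , isCycleGraph , residue))
    where open Spanning c shortest spans
  degenerateEvenCycle-rank connected h@(suc (suc h′)) c shortest degenerate _ ¬C₀ ¬C₂ | no ¬spans
    with Fin.¬∀⟶∃¬ n _ (λ x → Fin.any? λ i → Cycle.vert c i Fin.≟ x) ¬spans
  ... | x , x-off = offCycle-rank connected h c shortest (s≤s (s≤s (s≤s (≤-trans (s≤s z≤n) (m≤n+m (suc (suc h′)) h′)))))
                      (x , λ i vi≡x → x-off (i , vi≡x))

  shortestCycle-rank : Connected G → ∀ {m} (c : Cycle G m) → NoShorterCycle m →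
    ¬ (Balanced G × CompleteBipartite G × suc m ≡ 4) →
    ¬ (Balanced G × IsCycleGraph G × suc m % 4 ≡ 0) →
    ¬ (Unbalanced G × IsCycleGraph G × suc m % 4 ≡ 2) →
    RankAtLeast (adjMatrix G) (suc m)
  shortestCycle-rank connected c shortest ¬K ¬C₀ ¬C₂ with cycleLength-parity (Cycle.len≥3 c)
  ... | h , inj₁ refl = rankAtLeast-nonsingular (adjMatrix G) _ _
                          (inducedCycle-odd-nonsingular h (CycleSeq.closedWalk cycle) (shortest⇒chordless cycle shortest))
    where
    cycle : CycleSeq _ (toSeq (Cycle.vert c))
    cycle = Cycle→CycleSeq c
  ... | h , inj₂ refl with alternating h *ˢ cycleSignSeq (toSeq (Cycle.vert c)) (suc (h + h)) Sign.≟ Sign.+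
  ...   | no  degenerate    = degenerateEvenCycle-rank connected h c shortest degenerate ¬K ¬C₀ ¬C₂
  ...   | yes nondegenerate = rankAtLeast-nonsingular (adjMatrix G) _ _
          (inducedCycle-even-nonsingular h (CycleSeq.closedWalk cycle) (shortest⇒chordless cycle shortest) 2h≢0 nondegenerate)
    where
    cycle : CycleSeq _ (toSeq (Cycle.vert c))
    cycle = Cycle→CycleSeq c
    2h≢0 : h + h ≢ 0
    2h≢0 2h≡0 = ≤⇒≯ (Cycle.len≥3 c) (subst (λ x → suc x < 2) (sym 2h≡0) ≤-refl)

lemma3p3 : ∀ {n} (G : SignedGraph n) (g : ℕ) → Connected G → Girth G g →
    ¬ (Balanced G × CompleteBipartite G × g ≡ 4) →
    ¬ (Balanced G × IsCycleGraph G × g % 4 ≡ 0) →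
    ¬ (Unbalanced G × IsCycleGraph G × g % 4 ≡ 2) →
    ∀ r → IsRank (adjMatrix G) r → g ≤ r
lemma3p3 G g connected ((m , c , refl) , girth) ¬K ¬C₀ ¬C₂ r isRank =
  rankAtLeast⇒≤rank (adjMatrix G) (shortestCycle-rank G connected c (λ m′ c′ → ≤-pred (girth m′ c′)) ¬K ¬C₀ ¬C₂) isRank
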